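{- Unweighted Borda Manipulation can be solved in time $O^*(t^{2|\mathcal{C}|})$, where $t$ is the number of manipulators and $\mathcal{C}\cup\{p\}$ is the set of candidates.
   Context: Borda elections: a set of candidates $\mathcal{C}\cup\{p\}$ (with $p\notin\mathcal{C}$) and a multiset of votes, each vote being a bijection $\pi:\mathcal{C}\cup\{p\}\to\{1,\dots,|\mathcal{C}|+1\}$. A vote $\pi$ gives candidate $c$ the score $\pi(c)-1$; the total score of a candidate is the sum over all votes. $p$ wins only if it has strictly higher total score than every other candidate. Unweighted Borda Manipulation (UBM): input is an election with candidates $\mathcal{C}\cup\{p\}$ and a multiset $\Pi_{\mathcal{V}}$ of votes in which $p$ is not the winner, and a set $\mathcal{V}'$ of $t$ manipulators. Question: can the manipulators cast votes $\Pi_{\mathcal{V}'}$ so that with all votes $\Pi_{\mathcal{V}}\uplus\Pi_{\mathcal{V}'}$ the candidate $p$ has strictly higher total score than every candidate in $\mathcal{C}$? The notation $O^*(\cdot)$ suppresses factors polynomial in the input size. -}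

module Defs where

open import Data.Bool.Base using (Bool; true; false)
open import Data.Fin.Base using (Fin; zero; suc; toℕ)
open import Data.Fin.Permutation using (Permutation′; _⟨$⟩ʳ_)
open import Data.List.Base using (List; []; _∷_; map; tabulate; _++_)
open import Data.Nat.Base using (ℕ; zero; suc; _+_; _*_; _∸_; _^_; _≤_; _<_)
open import Data.Nat.ListAction using (sum)
open import Data.Product.Base using (Σ; ∃-syntax; _×_)
open import Data.Vec.Base as Vec using (Vec; []; _∷_)
open import Relation.Nullary.Negation.Core using (¬_)
open import Relation.Nullary.Reflects using (Reflects)

------------------------------------------------------------------------
-- Machine model: a first-order functional language with general recursion
-- over binary trees (Turing complete), in the style of N. D. Jones,
-- "Computability and Complexity from a Programming Perspective".
--
-- The running time is the number of evaluation rules applied.  Representing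
-- trees by pointers, a random access machine performs each rule of a fixed
-- program in constant time (the constant depends on the program only), so
-- a time bound here is, up to a constant factor, a RAM time bound.

infixr 5 _∙_

data Tree : Set where
  nil : Tree
  _∙_ : Tree → Tree → Tree

-- 'Expr r n' is an expression with n variables (de Bruijn indices into the
-- environment) occurring in the body of a function of r arguments.  'self'
-- calls that enclosing function; 'call' calls another function, given by
-- its own closed body.

data Expr (r n : ℕ) : Set where
  var    : Fin n → Expr r n
  nil    : Expr r n
  _∙_    : Expr r n → Expr r n → Expr r n
  case   : Expr r n → Expr r n → Expr r (suc (suc n)) → Expr r n
  let′   : Expr r n → Expr r (suc n) → Expr r n
  self   : Vec (Expr r n) r → Expr r n
  call   : ∀ {k} → Expr k k → Vec (Expr r n) k → Expr r n

Function : ℕ → Set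
Function r = Expr r r

Program : Set
Program = Function 1

-- f , ρ ⊢ e ⇓ v [ k ]: inside the function f and in the environment ρ, the
-- expression e evaluates (call by value) to v in k steps.

infix 4 _,_⊢_⇓_[_] _,_⊢*_⇓_[_]

mutual

  data _,_⊢_⇓_[_] {r n : ℕ} (f : Function r) (ρ : Vec Tree n) :
                  Expr r n → Tree → ℕ → Set where

    ⇓var  : ∀ {i} → f , ρ ⊢ var i ⇓ Vec.lookup ρ i [ 1 ]

    ⇓nil  : f , ρ ⊢ nil ⇓ nil [ 1 ]

    ⇓∙    : ∀ {e₁ e₂ v₁ v₂ k₁ k₂} →
            f , ρ ⊢ e₁ ⇓ v₁ [ k₁ ] →
            f , ρ ⊢ e₂ ⇓ v₂ [ k₂ ] →
            f , ρ ⊢ e₁ ∙ e₂ ⇓ v₁ ∙ v₂ [ suc (k₁ + k₂) ]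

    ⇓caseⁿ : ∀ {e e₁ e₂ v k l} →
            f , ρ ⊢ e ⇓ nil [ k ] →
            f , ρ ⊢ e₁ ⇓ v [ l ] →
            f , ρ ⊢ case e e₁ e₂ ⇓ v [ suc (k + l) ]

    ⇓case∙ : ∀ {e e₁ e₂ u₁ u₂ v k l} →
            f , ρ ⊢ e ⇓ u₁ ∙ u₂ [ k ] →
            f , u₁ ∷ u₂ ∷ ρ ⊢ e₂ ⇓ v [ l ] →
            f , ρ ⊢ case e e₁ e₂ ⇓ v [ suc (k + l) ]

    ⇓let  : ∀ {e₁ e₂ u v k l} →
            f , ρ ⊢ e₁ ⇓ u [ k ] →
            f , u ∷ ρ ⊢ e₂ ⇓ v [ l ] →
            f , ρ ⊢ let′ e₁ e₂ ⇓ v [ suc (k + l) ]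

    ⇓self : ∀ {es us v k l} →
            f , ρ ⊢* es ⇓ us [ k ] →
            f , us ⊢ f ⇓ v [ l ] →
            f , ρ ⊢ self es ⇓ v [ suc (k + l) ]

    ⇓call : ∀ {s es us v k l} {g : Function s} →
            f , ρ ⊢* es ⇓ us [ k ] →
            g , us ⊢ g ⇓ v [ l ] →
            f , ρ ⊢ call g es ⇓ v [ suc (k + l) ]

  data _,_⊢*_⇓_[_] {r n : ℕ} (f : Function r) (ρ : Vec Tree n) :
                   ∀ {s} → Vec (Expr r n) s → Vec Tree s → ℕ → Set where

    ⇓[]   : f , ρ ⊢* [] ⇓ [] [ 0 ]

    ⇓∷    : ∀ {s e v k l} {es : Vec (Expr r n) s} {vs : Vec Tree s} →
            f , ρ ⊢ e ⇓ v [ k ] →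
            f , ρ ⊢* es ⇓ vs [ l ] →
            f , ρ ⊢* e ∷ es ⇓ v ∷ vs [ k + l ]

Runs : Program → Tree → Tree → ℕ → Set
Runs f input output k = f , input ∷ [] ⊢ f ⇓ output [ k ]

-- At least 1, hence the O* bound below may use monomials only.
size : Tree → ℕ
size nil     = 1
size (x ∙ y) = suc (size x + size y)

encodeBool : Bool → Tree
encodeBool false = nil
encodeBool true  = nil ∙ nil

encodeℕ : ℕ → Tree
encodeℕ zero    = nil
encodeℕ (suc n) = nil ∙ encodeℕ n

encodeList : {A : Set} → (A → Tree) → List A → Tree
encodeList enc []       = nil
encodeList enc (x ∷ xs) = enc x ∙ encodeList enc xs

record DecisionProblem : Set₁ where
  field
    Instance : Set
    encode   : Instance → Tree
    Yes      : Instance → Set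

-- One program decides every instance x within c · |x|^d · g x steps, where
-- |x| is the size of the encoding of x.
SolvableInTimeO* : (P : DecisionProblem) → (DecisionProblem.Instance P → ℕ) → Set
SolvableInTimeO* P g =
  Σ Program λ f → ∃[ c ] ∃[ d ] ∀ (x : Instance) →
    ∃[ b ] ∃[ k ] Runs f (encode x) (encodeBool b) k
                × Reflects (Yes x) b
                × k ≤ c * size (encode x) ^ d * g x
  where open DecisionProblem P

------------------------------------------------------------------------
-- Borda elections.  With m = |𝒞|, the set 𝒞 ∪ {p} is Fin (suc m), where
-- p is zero and the members of 𝒞 are the successors.

Candidate : ℕ → Set
Candidate m = Fin (suc m)

p : ∀ {m} → Candidate m
p = zero

Vote : ℕ → Set
Vote m = Permutation′ (suc m)

-- Fin (suc m) is {0,…,m}; positions are {1,…,m+1}.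
position : ∀ {m} → Vote m → Candidate m → ℕ
position π c = suc (toℕ (π ⟨$⟩ʳ c))

score : ∀ {m} → Vote m → Candidate m → ℕ
score π c = position π c ∸ 1

-- Multisets of votes are lists, whose order the scores do not depend on.
totalScore : ∀ {m} → List (Vote m) → Candidate m → ℕ
totalScore Π c = sum (map (λ π → score π c) Π)

PWins : ∀ {m} → List (Vote m) → Set
PWins {m} Π = ∀ (c : Fin m) → totalScore Π (suc c) < totalScore Π p

record UBMInstance : Set where
  field
    #candidates   : ℕ                    -- |𝒞|, so p is not counted
    votes         : List (Vote #candidates)
    #manipulators : ℕ
    p-not-winner  : ¬ PWins votes

open UBMInstance public

CanManipulate : UBMInstance → Set
CanManipulate I =
  Σ (Vec (Vote (#candidates I)) (#manipulators I)) λ Π′ →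
    PWins (votes I ++ Vec.toList Π′)

encodeVote : ∀ {m} → Vote m → Tree
encodeVote π = encodeList encodeℕ (tabulate (position π))

-- Unary numbers keep the size polynomial in the number of candidates, votes
-- and manipulators: positions are at most |𝒞|+1, and the manipulators are
-- given as a set.
encodeUBM : UBMInstance → Tree
encodeUBM I = encodeℕ (#candidates I)
            ∙ encodeList encodeVote (votes I)
            ∙ encodeℕ (#manipulators I)

UBM : DecisionProblem
UBM = record
  { Instance = UBMInstance
  ; encode   = encodeUBM
  ; Yes      = CanManipulate
  }

{-# OPTIONS --safe #-}
module Submission where

-- With p on top of every manipulating vote, the question is whether the scores
-- 0, …, |𝒞|-1, each available t times, can be dealt to the members of 𝒞, t to each,
-- so that each c gets less than its gap, the final score of p minus the present
-- score of c.  Votes need not be tracked: a deal is a t-regular bipartite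
-- multigraph, hence a union of t perfect matchings, that is, of t votes.
--
-- For t ≥ 2 the deals are found by dynamic programming over the multisets of scores
-- still available.  A set of such multisets is a trie of depth |𝒞| and branching
-- t+1, so it has size O((t+1)^|𝒞|), and t+1 ≤ t².  For t = 1 this bound is too weak;
-- instead, the largest score goes to any candidate that can take it, which loses
-- nothing, since taking a candidate out of a vote only lowers the scores of the others.

-- All scores of one candidate are dealt before the next candidate starts, so a state needs only one
-- running total besides the scores left; remembering every total would cost a power of the budget.
-- The total is kept as an allowance still to be used up. It is bounded by `budget`, which is
-- polynomial because the input is unary. The size bound has to hold for every intermediate trie.
-- Sizes alone would not give it, since a union may double them; what is preserved is that no
-- operation leaves a fixed box. The search only ensures that no score is dealt more than t times.
-- As |𝒞| candidates receive t scores each and there are |𝒞| scores, each is then dealt exactly t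
-- times.

open import Defs
open import Data.Bool.Base using (Bool; true; false; if_then_else_)
open import Data.Bool.Properties using () renaming (_≟_ to _≟ᵇ_)
open import Data.Empty using (⊥)
open import Data.Fin.Base using (Fin; zero; suc; toℕ; fromℕ; fromℕ<; punchIn; punchOut)
open import Data.Fin.Permutation as Perm using (Permutation; Permutation′; permutation; _⟨$⟩ʳ_; _⟨$⟩ˡ_)
open import Data.Fin.Properties using (_≟_; any?; toℕ-fromℕ; toℕ-fromℕ<; toℕ<n; toℕ≤pred[n]; injective⇒≤; punchIn-punchOut; punchOut-injective)
open import Data.List.Base as List using (List; []; _∷_; tabulate; length; _++_)
open import Data.List.Properties using (length-tabulate; ++-identityʳ)
open import Data.List.Relation.Unary.All using (All; []; _∷_)
open import Data.List.Relation.Unary.All.Properties using (tabulate⁺)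
open import Data.Nat.Base using (ℕ; zero; suc; _+_; _*_; _∸_; _^_; _⊔_; _≤_; _<_; z≤n; s≤s; >-nonZero)
open import Data.Nat.Properties hiding (_≟_)
open import Algebra.Properties.Semiring.Sum +-*-semiring using (sum; sum-cong-≗; sum-permute; ∑-comm; ∑-distrib-+; *-distribˡ-sum)
open import Data.Nat.Tactic.RingSolver using (solve)
open import Data.Product.Base using (∃; ∃₂; _×_; _,_; proj₁; proj₂; map; map₂)
open import Data.Sum.Base using (_⊎_; inj₁; inj₂)
open import Data.Unit.Base using (⊤; tt)
open import Data.Vec.Base as Vec using (Vec; []; _∷_)
open import Data.Vec.Functional using (Vector; updateAt)
open import Data.Vec.Functional.Properties using (updateAt-updates; updateAt-minimal)
open import Function.Base using (_∘_; const; id)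
open import Function.Definitions using (Injective)
open import Relation.Binary.PropositionalEquality
open import Relation.Nullary.Decidable.Core using (Dec; yes; no; _×-dec_; ¬?)
open import Relation.Nullary.Negation.Core using (¬_; contradiction)
open import Relation.Nullary.Reflects using (Reflects; ofʸ; ofⁿ)

-- Bounded evaluation

infix 4 _,_⊢_⇓_⟨_⟩ _,_⊢*_⇓_⟨_⟩

-- Steps are bounded from above only, so that the costs of subevaluations add up by monotonicity and
-- `relax` can round them to a closed form.
record _,_⊢_⇓_⟨_⟩ {r n} (f : Function r) (ρ : Vec Tree n) (e : Expr r n) (v : Tree) (b : ℕ) : Set where
  constructor within
  field
    {steps}    : ℕ
    derivation : f , ρ ⊢ e ⇓ v [ steps ]
    bound      : steps ≤ b

record _,_⊢*_⇓_⟨_⟩ {r n s} (f : Function r) (ρ : Vec Tree n) (es : Vec (Expr r n) s) (vs : Vec Tree s) (b : ℕ) : Set where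
  constructor within
  field
    {steps}    : ℕ
    derivation : f , ρ ⊢* es ⇓ vs [ steps ]
    bound      : steps ≤ b

module _ {r n} {f : Function r} {ρ : Vec Tree n} where

  infixr 5 _∷ᵇ_

  varᵇ : ∀ {i} → f , ρ ⊢ var i ⇓ Vec.lookup ρ i ⟨ 1 ⟩
  varᵇ = within ⇓var ≤-refl

  nilᵇ : f , ρ ⊢ nil ⇓ nil ⟨ 1 ⟩
  nilᵇ = within ⇓nil ≤-refl

  consᵇ : ∀ {e₁ e₂ v₁ v₂ b₁ b₂} → f , ρ ⊢ e₁ ⇓ v₁ ⟨ b₁ ⟩ → f , ρ ⊢ e₂ ⇓ v₂ ⟨ b₂ ⟩ →
          f , ρ ⊢ e₁ ∙ e₂ ⇓ v₁ ∙ v₂ ⟨ suc (b₁ + b₂) ⟩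
  consᵇ (within d₁ k₁) (within d₂ k₂) = within (⇓∙ d₁ d₂) (s≤s (+-mono-≤ k₁ k₂))

  caseⁿᵇ : ∀ {e e₁ e₂ v b₁ b₂} → f , ρ ⊢ e ⇓ nil ⟨ b₁ ⟩ → f , ρ ⊢ e₁ ⇓ v ⟨ b₂ ⟩ →
           f , ρ ⊢ case e e₁ e₂ ⇓ v ⟨ suc (b₁ + b₂) ⟩
  caseⁿᵇ (within d₁ k₁) (within d₂ k₂) = within (⇓caseⁿ d₁ d₂) (s≤s (+-mono-≤ k₁ k₂))

  case∙ᵇ : ∀ {e e₁ e₂ u₁ u₂ v b₁ b₂} → f , ρ ⊢ e ⇓ u₁ ∙ u₂ ⟨ b₁ ⟩ → f , u₁ ∷ u₂ ∷ ρ ⊢ e₂ ⇓ v ⟨ b₂ ⟩ →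
           f , ρ ⊢ case e e₁ e₂ ⇓ v ⟨ suc (b₁ + b₂) ⟩
  case∙ᵇ (within d₁ k₁) (within d₂ k₂) = within (⇓case∙ d₁ d₂) (s≤s (+-mono-≤ k₁ k₂))

  selfᵇ : ∀ {es us v b₁ b₂} → f , ρ ⊢* es ⇓ us ⟨ b₁ ⟩ → f , us ⊢ f ⇓ v ⟨ b₂ ⟩ →
          f , ρ ⊢ self es ⇓ v ⟨ suc (b₁ + b₂) ⟩
  selfᵇ (within d₁ k₁) (within d₂ k₂) = within (⇓self d₁ d₂) (s≤s (+-mono-≤ k₁ k₂))

  callᵇ : ∀ {s es us v b₁ b₂} {g : Function s} → f , ρ ⊢* es ⇓ us ⟨ b₁ ⟩ → g , us ⊢ g ⇓ v ⟨ b₂ ⟩ →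
          f , ρ ⊢ call g es ⇓ v ⟨ suc (b₁ + b₂) ⟩
  callᵇ (within d₁ k₁) (within d₂ k₂) = within (⇓call d₁ d₂) (s≤s (+-mono-≤ k₁ k₂))

  []ᵇ : f , ρ ⊢* [] ⇓ [] ⟨ 0 ⟩
  []ᵇ = within ⇓[] ≤-refl

  _∷ᵇ_ : ∀ {s e v b₁ b₂} {es : Vec (Expr r n) s} {vs : Vec Tree s} →
         f , ρ ⊢ e ⇓ v ⟨ b₁ ⟩ → f , ρ ⊢* es ⇓ vs ⟨ b₂ ⟩ → f , ρ ⊢* e ∷ es ⇓ v ∷ vs ⟨ b₁ + b₂ ⟩
  within d₁ k₁ ∷ᵇ within d₂ k₂ = within (⇓∷ d₁ d₂) (+-mono-≤ k₁ k₂)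

  relax : ∀ {e v b b′} → f , ρ ⊢ e ⇓ v ⟨ b ⟩ → b ≤ b′ → f , ρ ⊢ e ⇓ v ⟨ b′ ⟩
  relax (within d k) b≤b′ = within d (≤-trans k b≤b′)

≤-slack : ∀ {a b} s → a + s ≡ b → a ≤ b
≤-slack s refl = m≤m+n _ s

-- Programs and their running times

pattern v₀ = var zero
pattern v₁ = var (suc zero)
pattern v₂ = var (suc (suc zero))
pattern v₃ = var (suc (suc (suc zero)))
pattern v₄ = var (suc (suc (suc (suc zero))))
pattern v₅ = var (suc (suc (suc (suc (suc zero)))))

size≥1 : ∀ T → 1 ≤ size T
size≥1 nil     = ≤-refl
size≥1 (_ ∙ _) = s≤s z≤n

encodeℕs : List ℕ → Tree
encodeℕs = encodeList encodeℕ

-- Unary arithmetic and tallies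

addᵖ : Function 2
addᵖ = case v₀ v₁ (nil ∙ self (v₁ ∷ v₃ ∷ []))

addᵖ-runs : ∀ x y → addᵖ , encodeℕ x ∷ encodeℕ y ∷ [] ⊢ addᵖ ⇓ encodeℕ (x + y) ⟨ 4 * size (encodeℕ x) ⟩
addᵖ-runs zero    y = relax (caseⁿᵇ varᵇ varᵇ) (n≤1+n 3)
addᵖ-runs (suc x) y = relax
  (case∙ᵇ varᵇ (consᵇ nilᵇ (selfᵇ (varᵇ ∷ᵇ varᵇ ∷ᵇ []ᵇ) (addᵖ-runs x y))))
  (arith (size (encodeℕ x)))
  where
  arith : ∀ s → 7 + 4 * s ≤ 4 * (2 + s)
  arith s = ≤-slack 1 (solve (s List.∷ List.[]))

mulᵖ : Function 2
mulᵖ = case v₀ nil (call addᵖ (v₃ ∷ self (v₁ ∷ v₃ ∷ []) ∷ []))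

mulᵖ-runs : ∀ x y → mulᵖ , encodeℕ x ∷ encodeℕ y ∷ [] ⊢ mulᵖ ⇓ encodeℕ (x * y)
            ⟨ size (encodeℕ x) * (4 * size (encodeℕ y) + 4) ⟩
mulᵖ-runs zero    y = relax (caseⁿᵇ varᵇ nilᵇ) (arith (size (encodeℕ y)))
  where
  arith : ∀ s → 3 ≤ 1 * (4 * s + 4)
  arith s = ≤-slack (4 * s + 1) (solve (s List.∷ List.[]))
mulᵖ-runs (suc x) y = relax
  (case∙ᵇ varᵇ (callᵇ (varᵇ ∷ᵇ selfᵇ (varᵇ ∷ᵇ varᵇ ∷ᵇ []ᵇ) (mulᵖ-runs x y) ∷ᵇ []ᵇ) (addᵖ-runs y (x * y))))
  (arith (size (encodeℕ x)) (size (encodeℕ y)))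
  where
  arith : ∀ s t → 7 + (s * (4 * t + 4) + 0 + 4 * t) ≤ (2 + s) * (4 * t + 4)
  arith s t = ≤-slack (4 * t + 1) (solve (s List.∷ t List.∷ List.[]))

monusᵖ : Function 2
monusᵖ = case v₁ v₀ (case v₂ nil (self (v₁ ∷ v₃ ∷ [])))

monusᵖ-runs : ∀ x y → monusᵖ , encodeℕ x ∷ encodeℕ y ∷ [] ⊢ monusᵖ ⇓ encodeℕ (x ∸ y) ⟨ 4 * size (encodeℕ y) ⟩
monusᵖ-runs x       zero    = relax (caseⁿᵇ varᵇ varᵇ) (n≤1+n 3)
monusᵖ-runs zero    (suc y) = relax (case∙ᵇ varᵇ (caseⁿᵇ varᵇ nilᵇ)) (arith (size (encodeℕ y)))
  where
  arith : ∀ s → 5 ≤ 4 * (2 + s)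
  arith s = ≤-slack (3 + 4 * s) (solve (s List.∷ List.[]))
monusᵖ-runs (suc x) (suc y) = relax
  (case∙ᵇ varᵇ (case∙ᵇ varᵇ (selfᵇ (varᵇ ∷ᵇ varᵇ ∷ᵇ []ᵇ) (monusᵖ-runs x y))))
  (arith (size (encodeℕ y)))
  where
  arith : ∀ s → 7 + 4 * s ≤ 4 * (2 + s)
  arith s = ≤-slack 1 (solve (s List.∷ List.[]))

zipAddᵖ : Function 2
zipAddᵖ = case v₀ nil (case v₃ nil (call addᵖ (v₂ ∷ v₀ ∷ []) ∙ self (v₃ ∷ v₁ ∷ [])))

zipAddᵖ-runs : ∀ {n} (f g : Fin n → ℕ) →
  zipAddᵖ , encodeℕs (tabulate f) ∷ encodeℕs (tabulate g) ∷ [] ⊢ zipAddᵖ ⇓ encodeℕs (tabulate (λ i → f i + g i))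
  ⟨ 11 * size (encodeℕs (tabulate f)) ⟩
zipAddᵖ-runs {zero}  f g = relax (caseⁿᵇ varᵇ nilᵇ) (m≤m+n 3 8)
zipAddᵖ-runs {suc n} f g = relax
  (case∙ᵇ varᵇ (case∙ᵇ varᵇ (consᵇ
    (callᵇ (varᵇ ∷ᵇ varᵇ ∷ᵇ []ᵇ) (addᵖ-runs (f zero) (g zero)))
    (selfᵇ (varᵇ ∷ᵇ varᵇ ∷ᵇ []ᵇ) (zipAddᵖ-runs (f ∘ suc) (g ∘ suc))))))
  (arith (size (encodeℕ (f zero))) (size (encodeℕs (tabulate (f ∘ suc)))))
  where
  arith : ∀ s t → 8 + (4 * s + (3 + 11 * t)) ≤ 11 * (1 + (s + t))
  arith s t = ≤-slack (7 * s) (solve (s List.∷ t List.∷ List.[]))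

gapsᵖ : Function 2
gapsᵖ = case v₁ nil (call monusᵖ (v₂ ∷ v₀ ∷ []) ∙ self (v₂ ∷ v₁ ∷ []))

gapsᵖ-runs : ∀ {n} b (g : Fin n → ℕ) →
  gapsᵖ , encodeℕ b ∷ encodeℕs (tabulate g) ∷ [] ⊢ gapsᵖ ⇓ encodeℕs (tabulate (λ i → b ∸ g i))
  ⟨ 9 * size (encodeℕs (tabulate g)) ⟩
gapsᵖ-runs {zero}  b g = relax (caseⁿᵇ varᵇ nilᵇ) (m≤m+n 3 6)
gapsᵖ-runs {suc n} b g = relax
  (case∙ᵇ varᵇ (consᵇ
    (callᵇ (varᵇ ∷ᵇ varᵇ ∷ᵇ []ᵇ) (monusᵖ-runs b (g zero)))
    (selfᵇ (varᵇ ∷ᵇ varᵇ ∷ᵇ []ᵇ) (gapsᵖ-runs b (g ∘ suc)))))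
  (arith (size (encodeℕ (g zero))) (size (encodeℕs (tabulate (g ∘ suc)))))
  where
  arith : ∀ s t → 6 + (4 * s + (3 + 9 * t)) ≤ 9 * (1 + (s + t))
  arith s t = ≤-slack (5 * s) (solve (s List.∷ t List.∷ List.[]))

accumulate : ∀ {m} → List (Vote m) → (Candidate m → ℕ) → Candidate m → ℕ
accumulate []      g = g
accumulate (π ∷ Π) g = accumulate Π (λ c → position π c + g c)

tallyᵖ : Function 2
tallyᵖ = case v₀ v₁ (self (v₁ ∷ call zipAddᵖ (v₀ ∷ v₃ ∷ []) ∷ []))

tallyᵖ-runs : ∀ {m} (Π : List (Vote m)) g →
  tallyᵖ , encodeList encodeVote Π ∷ encodeℕs (tabulate g) ∷ [] ⊢ tallyᵖ ⇓ encodeℕs (tabulate (accumulate Π g))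
  ⟨ 11 * size (encodeList encodeVote Π) ⟩
tallyᵖ-runs []      g = relax (caseⁿᵇ varᵇ varᵇ) (m≤m+n 3 8)
tallyᵖ-runs (π ∷ Π) g = relax
  (case∙ᵇ varᵇ (selfᵇ
    (varᵇ ∷ᵇ callᵇ (varᵇ ∷ᵇ varᵇ ∷ᵇ []ᵇ) (zipAddᵖ-runs (position π) g) ∷ᵇ []ᵇ)
    (tallyᵖ-runs Π _)))
  (arith (size (encodeVote π)) (size (encodeList encodeVote Π)))
  where
  arith : ∀ s t → 7 + (11 * s + 0 + 11 * t) ≤ 11 * (1 + (s + t))
  arith s t = ≤-slack 4 (solve (s List.∷ t List.∷ List.[]))

-- Tries of multisets

copies : ℕ → Tree → Tree
copies zero    T = nil
copies (suc n) T = T ∙ copies n T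

copiesᵖ : Function 2
copiesᵖ = case v₀ nil (v₃ ∙ self (v₁ ∷ v₃ ∷ []))

-- The cost does not depend on `size T`, because duplicating a tree is a single variable lookup.
-- Hence a box of exponential size is built in polynomial time.
copiesᵖ-runs : ∀ n T → copiesᵖ , encodeℕ n ∷ T ∷ [] ⊢ copiesᵖ ⇓ copies n T ⟨ 4 * size (encodeℕ n) ⟩
copiesᵖ-runs zero    T = relax (caseⁿᵇ varᵇ nilᵇ) (n≤1+n 3)
copiesᵖ-runs (suc n) T = relax
  (case∙ᵇ varᵇ (consᵇ varᵇ (selfᵇ (varᵇ ∷ᵇ varᵇ ∷ᵇ []ᵇ) (copiesᵖ-runs n T))))
  (arith (size (encodeℕ n)))
  where
  arith : ∀ s → 7 + 4 * s ≤ 4 * (2 + s)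
  arith s = ≤-slack 1 (solve (s List.∷ List.[]))

-- A trie of depth m stands for a set of vectors in ℕ^m: its i-th child, if any,
-- holds the tails of the vectors with head i, and a leaf is nonempty iff it is not
-- nil.  The trie 'box m n' is {0, …, n-1}^m.
box : ℕ → ℕ → Tree
box zero    n = nil ∙ nil
box (suc m) n = copies n (box m n)

boxᵖ : Function 2
boxᵖ = case v₀ (nil ∙ nil) (call copiesᵖ (v₃ ∷ self (v₁ ∷ v₃ ∷ []) ∷ []))

boxᵖ-runs : ∀ m n → boxᵖ , encodeℕ m ∷ encodeℕ n ∷ [] ⊢ boxᵖ ⇓ box m n
            ⟨ size (encodeℕ m) * (4 * size (encodeℕ n) + 5) ⟩
boxᵖ-runs zero    n = relax (caseⁿᵇ varᵇ (consᵇ nilᵇ nilᵇ)) (arith (size (encodeℕ n)))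
  where
  arith : ∀ s → 5 ≤ 1 * (4 * s + 5)
  arith s = ≤-slack (4 * s) (solve (s List.∷ List.[]))
boxᵖ-runs (suc m) n = relax
  (case∙ᵇ varᵇ (callᵇ (varᵇ ∷ᵇ selfᵇ (varᵇ ∷ᵇ varᵇ ∷ᵇ []ᵇ) (boxᵖ-runs m n) ∷ᵇ []ᵇ) (copiesᵖ-runs n (box m n))))
  (arith (size (encodeℕ m)) (size (encodeℕ n)))
  where
  arith : ∀ s t → 7 + (s * (4 * t + 5) + 0 + 4 * t) ≤ (2 + s) * (4 * t + 5)
  arith s t = ≤-slack (4 * t + 3) (solve (s List.∷ t List.∷ List.[]))

union : Tree → Tree → Tree
union nil     y       = y
union (a ∙ b) nil     = a ∙ b
union (a ∙ b) (c ∙ d) = union a c ∙ union b d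

unionᵖ : Function 2
unionᵖ = case v₀ v₁ (case v₃ v₂ (self (v₂ ∷ v₀ ∷ []) ∙ self (v₃ ∷ v₁ ∷ [])))

-- The 11 steps per node shared by `unionᵖ` and `lowerᵖ`: two case tests with their variables (4),
-- the pairing (1) and two self calls with two arguments each (6).
linear-cost₂ : ∀ s t → 8 + (11 * s + (3 + 11 * t)) ≤ 11 * (1 + (s + t))
linear-cost₂ s t = ≤-slack 0 (solve (s List.∷ t List.∷ List.[]))

linear-cost₁ : ∀ s → 5 ≤ 11 * (1 + s)
linear-cost₁ s = ≤-slack (6 + 11 * s) (solve (s List.∷ List.[]))

-- Every recursive call descends into `x`, so the size of `y` is never paid for. The bound of
-- `drawᵖ-runs`, linear in `R`, rests on this.
unionᵖ-runs : ∀ x y → unionᵖ , x ∷ y ∷ [] ⊢ unionᵖ ⇓ union x y ⟨ 11 * size x ⟩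
unionᵖ-runs nil     y       = relax (caseⁿᵇ varᵇ varᵇ) (m≤m+n 3 8)
unionᵖ-runs (a ∙ b) nil     = relax {v = a ∙ b} (case∙ᵇ varᵇ (caseⁿᵇ varᵇ varᵇ)) (linear-cost₁ (size a + size b))
unionᵖ-runs (a ∙ b) (c ∙ d) = relax
  (case∙ᵇ varᵇ (case∙ᵇ varᵇ (consᵇ
    (selfᵇ (varᵇ ∷ᵇ varᵇ ∷ᵇ []ᵇ) (unionᵖ-runs a c))
    (selfᵇ (varᵇ ∷ᵇ varᵇ ∷ᵇ []ᵇ) (unionᵖ-runs b d)))))
  (linear-cost₂ (size a) (size b))

-- 'lower j T' is {v ∣ v + eⱼ ∈ T}.
lower : ℕ → Tree → Tree
lower j       nil     = nil
lower zero    (a ∙ b) = b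
lower (suc j) (a ∙ b) = lower j a ∙ lower (suc j) b

lowerᵖ : Function 2
lowerᵖ = case v₁ nil (case v₂ v₁ (self (v₁ ∷ v₂ ∷ []) ∙ self (v₄ ∷ v₃ ∷ [])))

lowerᵖ-runs : ∀ j T → lowerᵖ , encodeℕ j ∷ T ∷ [] ⊢ lowerᵖ ⇓ lower j T ⟨ 11 * size T ⟩
lowerᵖ-runs j       nil     = relax (caseⁿᵇ varᵇ nilᵇ) (m≤m+n 3 8)
lowerᵖ-runs zero    (a ∙ b) = relax (case∙ᵇ varᵇ (caseⁿᵇ varᵇ varᵇ)) (linear-cost₁ (size a + size b))
lowerᵖ-runs (suc j) (a ∙ b) = relax
  (case∙ᵇ varᵇ (case∙ᵇ varᵇ (consᵇ
    (selfᵇ (varᵇ ∷ᵇ varᵇ ∷ᵇ []ᵇ) (lowerᵖ-runs j a))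
    (selfᵇ (varᵇ ∷ᵇ varᵇ ∷ᵇ []ᵇ) (lowerᵖ-runs (suc j) b)))))
  (linear-cost₂ (size a) (size b))

lower-size : ∀ j T → size (lower j T) ≤ size T
lower-size j       nil     = ≤-refl
lower-size zero    (a ∙ b) = m≤n⇒m≤1+n (m≤n+m (size b) (size a))
lower-size (suc j) (a ∙ b) = s≤s (+-mono-≤ (lower-size j a) (lower-size (suc j) b))

-- The score and the position in the list advance together: dealing score j uses up j of the
-- allowance, so allowance i is reached from allowance i + j.
draw : ℕ → ℕ → Tree → Tree
draw j zero    R       = nil
draw j (suc k) nil     = nil
draw j (suc k) (S ∙ R) = union (lower j S) (draw (suc j) k R)

drawᵖ : Function 3
drawᵖ = case v₁ nil (case v₄ nil
  (call unionᵖ (call lowerᵖ (v₄ ∷ v₀ ∷ []) ∷ self ((nil ∙ v₄) ∷ v₃ ∷ v₁ ∷ []) ∷ [])))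

drawᵖ-runs : ∀ j k R → drawᵖ , encodeℕ j ∷ encodeℕ k ∷ R ∷ [] ⊢ drawᵖ ⇓ draw j k R ⟨ 22 * size R ⟩
drawᵖ-runs j zero R = relax (caseⁿᵇ varᵇ nilᵇ) (≤-trans (m≤m+n 3 19) (*-monoʳ-≤ 22 (size≥1 R)))
drawᵖ-runs j (suc k) nil     = relax (case∙ᵇ varᵇ (caseⁿᵇ varᵇ nilᵇ)) (m≤m+n 5 17)
drawᵖ-runs j (suc k) (S ∙ R) = relax
  (case∙ᵇ varᵇ (case∙ᵇ varᵇ (callᵇ
    (callᵇ (varᵇ ∷ᵇ varᵇ ∷ᵇ []ᵇ) (lowerᵖ-runs j S)
      ∷ᵇ selfᵇ (consᵇ nilᵇ varᵇ ∷ᵇ varᵇ ∷ᵇ varᵇ ∷ᵇ []ᵇ) (drawᵖ-runs (suc j) k R)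
      ∷ᵇ []ᵇ)
    (unionᵖ-runs (lower j S) (draw (suc j) k R)))))
  (≤-trans (+-monoʳ-≤ 8 (+-monoʳ-≤ (11 * size S + (6 + 22 * size R + 0)) (*-monoʳ-≤ 11 (lower-size j S))))
    (arith (size S) (size R)))
  where
  arith : ∀ s t → 8 + (11 * s + (6 + 22 * t + 0) + 11 * s) ≤ 22 * (1 + (s + t))
  arith s t = ≤-slack 8 (solve (s List.∷ t List.∷ List.[]))

-- Containment in a box

infix 4 _⊑_

-- `S ⊑ T` when S arises from T by replacing subtrees with `nil`. Two trees inside T have their
-- union inside T, so this bound survives arbitrarily many unions.
data _⊑_ : Tree → Tree → Set where
  nil : ∀ {T} → nil ⊑ T
  _∙_ : ∀ {a b c d} → a ⊑ c → b ⊑ d → a ∙ b ⊑ c ∙ d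

⊑-refl : ∀ {T} → T ⊑ T
⊑-refl {nil}   = nil
⊑-refl {_ ∙ _} = ⊑-refl ∙ ⊑-refl

⊑-size : ∀ {S T} → S ⊑ T → size S ≤ size T
⊑-size {T = T} nil = size≥1 T
⊑-size (a ∙ b)     = s≤s (+-mono-≤ (⊑-size a) (⊑-size b))

union-⊑ : ∀ {x y T} → x ⊑ T → y ⊑ T → union x y ⊑ T
union-⊑ nil     y       = y
union-⊑ (a ∙ b) nil     = a ∙ b
union-⊑ (a ∙ b) (c ∙ d) = union-⊑ a c ∙ union-⊑ b d

copies-⊑ : ∀ {m n S T} → m ≤ n → S ⊑ T → copies m S ⊑ copies n T
copies-⊑ z≤n     S⊑T = nil
copies-⊑ (s≤s h) S⊑T = S⊑T ∙ copies-⊑ h S⊑T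

copies-suc-⊑ : ∀ n {T R} → R ⊑ copies n T → R ⊑ copies (suc n) T
copies-suc-⊑ zero    nil        = nil
copies-suc-⊑ (suc n) nil        = nil
copies-suc-⊑ (suc n) (S⊑T ∙ R⊑) = S⊑T ∙ copies-suc-⊑ n R⊑

lower-copies-⊑ : ∀ n {T R} → R ⊑ copies n T → lower 0 R ⊑ copies n T
lower-copies-⊑ zero    nil      = nil
lower-copies-⊑ (suc n) nil      = nil
lower-copies-⊑ (suc n) (_ ∙ R⊑) = copies-suc-⊑ n R⊑

lower-map-⊑ : ∀ {j T} → (∀ {S} → S ⊑ T → lower j S ⊑ T) →
              ∀ n {R} → R ⊑ copies n T → lower (suc j) R ⊑ copies n T
lower-map-⊑ h zero    nil        = nil
lower-map-⊑ h (suc n) nil        = nil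
lower-map-⊑ h (suc n) (S⊑T ∙ R⊑) = h S⊑T ∙ lower-map-⊑ h n R⊑

lower-box-⊑ : ∀ m n j {S} → S ⊑ box m n → lower j S ⊑ box m n
lower-box-⊑ zero    n j       nil         = nil
lower-box-⊑ zero    n zero    (nil ∙ nil) = nil
lower-box-⊑ zero    n (suc j) (nil ∙ nil) = nil ∙ nil
lower-box-⊑ (suc m) n zero    S⊑          = lower-copies-⊑ n S⊑
lower-box-⊑ (suc m) n (suc j) S⊑          = lower-map-⊑ (lower-box-⊑ m n j) n S⊑

draw-⊑ : ∀ m n b j k {R} → R ⊑ copies b (box m n) → draw j k R ⊑ box m n
draw-⊑ m n b       j zero    R⊑        = nil
draw-⊑ m n zero    j (suc k) nil       = nil
draw-⊑ m n (suc b) j (suc k) nil       = nil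
draw-⊑ m n (suc b) j (suc k) (S⊑ ∙ R⊑) = union-⊑ (lower-box-⊑ m n j S⊑) (draw-⊑ m n b (suc j) k R⊑)

-- The i-th trie of R holds the scores left when the current candidate may still get
-- a total of i; a step deals one more score to that candidate.
step : ℕ → Tree → Tree
step m nil     = nil
step m (S ∙ R) = draw 0 m (S ∙ R) ∙ step m R

step-⊑ : ∀ m n b {R} → R ⊑ copies b (box m n) → step m R ⊑ copies b (box m n)
step-⊑ m n zero    nil       = nil
step-⊑ m n (suc b) nil       = nil
step-⊑ m n (suc b) (S⊑ ∙ R⊑) = draw-⊑ m n (suc b) 0 m (S⊑ ∙ R⊑) ∙ step-⊑ m n b R⊑

stepᵖ : Function 2
stepᵖ = case v₁ nil (call drawᵖ (nil ∷ v₂ ∷ v₃ ∷ []) ∙ self (v₂ ∷ v₁ ∷ []))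

-- The containment bounds the length of the list by b. Each entry costs one draw from the remaining
-- list, at most 22 s, plus an overhead of 10, which s ≥ 1 absorbs.
stepᵖ-runs : ∀ m b {R T s} → R ⊑ copies b T → size R ≤ s →
             stepᵖ , encodeℕ m ∷ R ∷ [] ⊢ stepᵖ ⇓ step m R ⟨ 32 * ((1 + b) * s) ⟩
stepᵖ-runs m b {nil} {s = s} _ 1≤s = relax (caseⁿᵇ varᵇ nilᵇ)
  (≤-trans (m≤m+n 3 29) (*-monoʳ-≤ 32 (*-mono-≤ (s≤s (z≤n {b})) 1≤s)))
stepᵖ-runs m (suc b) {S ∙ R} {s = s} (_ ∙ R⊑) h = relax
  (case∙ᵇ varᵇ (consᵇ
    (callᵇ (nilᵇ ∷ᵇ varᵇ ∷ᵇ varᵇ ∷ᵇ []ᵇ) (drawᵖ-runs 0 m (S ∙ R)))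
    (selfᵇ (varᵇ ∷ᵇ varᵇ ∷ᵇ []ᵇ) (stepᵖ-runs m b {s = s} R⊑ (≤-trans (m≤n+m _ _) (≤-trans (n≤1+n _) h))))))
  (≤-trans (+-monoʳ-≤ 7 (+-monoˡ-≤ (3 + 32 * ((1 + b) * s)) (*-monoʳ-≤ 22 h)))
    (≤-trans (+-monoˡ-≤ (22 * s + (3 + 32 * ((1 + b) * s))) (≤-trans (m≤m+n 7 0) (*-monoʳ-≤ 7 1≤s)))
      (≤-trans (+-monoʳ-≤ (7 * s) (+-monoʳ-≤ (22 * s) (+-monoˡ-≤ (32 * ((1 + b) * s)) (*-monoʳ-≤ 3 1≤s))))
        (arith b s))))
  where
  1≤s : 1 ≤ s
  1≤s = ≤-trans (s≤s z≤n) h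
  arith : ∀ b s → 7 * s + (22 * s + (3 * s + 32 * ((1 + b) * s))) ≤ 32 * ((2 + b) * s)
  arith b s = ≤-slack 0 (solve (b List.∷ s List.∷ List.[]))

-- Dealing to one candidate, then to all

iterate : ℕ → ℕ → Tree → Tree
iterate zero    m R = R
iterate (suc t) m R = iterate t m (step m R)

iterate-⊑ : ∀ t m n b {R} → R ⊑ copies b (box m n) → iterate t m R ⊑ copies b (box m n)
iterate-⊑ zero    m n b R⊑ = R⊑
iterate-⊑ (suc t) m n b R⊑ = iterate-⊑ t m n b (step-⊑ m n b R⊑)

iterateᵖ : Function 3
iterateᵖ = case v₀ v₂ (self (v₁ ∷ v₃ ∷ call stepᵖ (v₃ ∷ v₄ ∷ []) ∷ []))

stepCost : ℕ → ℕ → ℕ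
stepCost b s = 8 + 32 * ((1 + b) * s)

iterateᵖ-runs : ∀ t m n b {R s} → R ⊑ copies b (box m n) → size (copies b (box m n)) ≤ s →
  iterateᵖ , encodeℕ t ∷ encodeℕ m ∷ R ∷ [] ⊢ iterateᵖ ⇓ iterate t m R ⟨ (1 + t) * stepCost b s ⟩
iterateᵖ-runs zero    m n b {s = s} R⊑ h = relax (caseⁿᵇ varᵇ varᵇ)
  (≤-trans (m≤m+n 3 _) (≤-reflexive (sym (*-identityˡ (stepCost b s)))))
iterateᵖ-runs (suc t) m n b {s = s} R⊑ h = relax
  (case∙ᵇ varᵇ (selfᵇ
    (varᵇ ∷ᵇ varᵇ ∷ᵇ callᵇ (varᵇ ∷ᵇ varᵇ ∷ᵇ []ᵇ) (stepᵖ-runs m b R⊑ (≤-trans (⊑-size R⊑) h)) ∷ᵇ []ᵇ)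
    (iterateᵖ-runs t m n b (step-⊑ m n b R⊑) h)))
  (arith t (32 * ((1 + b) * s)))
  where
  arith : ∀ t c → 8 + (c + 0 + (1 + t) * (8 + c)) ≤ (2 + t) * (8 + c)
  arith t c = ≤-slack 0 (solve (t List.∷ c List.∷ List.[]))

head : Tree → Tree
head nil     = nil
head (a ∙ _) = a

head-⊑ : ∀ n {R T} → R ⊑ copies n T → head R ⊑ T
head-⊑ zero    nil       = nil
head-⊑ (suc n) nil       = nil
head-⊑ (suc n) (S⊑T ∙ _) = S⊑T

-- A candidate may start from any allowance below its gap, so allowance 0 at the end
-- accounts for every total below the gap.
allot : List ℕ → ℕ → ℕ → Tree → Tree
allot []       t m S = S
allot (b ∷ bs) t m S = allot bs t m (head (iterate t m (copies b S)))

allot-⊑ : ∀ bs t m n {S} → S ⊑ box m n → allot bs t m S ⊑ box m n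
allot-⊑ []       t m n S⊑ = S⊑
allot-⊑ (b ∷ bs) t m n S⊑ = allot-⊑ bs t m n (head-⊑ b (iterate-⊑ t m n b (copies-⊑ ≤-refl S⊑)))

allotᵖ : Function 4
allotᵖ = case v₀ v₃ (self (v₁ ∷ v₃ ∷ v₄ ∷
  case (call iterateᵖ (v₃ ∷ v₄ ∷ call copiesᵖ (v₀ ∷ v₅ ∷ []) ∷ [])) nil v₀ ∷ []))

headᵇ : ∀ {r n} {f : Function r} {ρ : Vec Tree n} {e T b} →
        f , ρ ⊢ e ⇓ T ⟨ b ⟩ → f , ρ ⊢ case e nil v₀ ⇓ head T ⟨ suc (b + 1) ⟩
headᵇ {T = nil}   d = caseⁿᵇ d nilᵇ
headᵇ {T = _ ∙ _} d = case∙ᵇ d varᵇ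

encodeℕ-size-mono : ∀ {m n} → m ≤ n → size (encodeℕ m) ≤ size (encodeℕ n)
encodeℕ-size-mono z≤n     = size≥1 _
encodeℕ-size-mono (s≤s h) = s≤s (s≤s (encodeℕ-size-mono h))

allotᵖ-runs : ∀ {bs} t m n {B S s} → All (_≤ B) bs → S ⊑ box m n → size (copies B (box m n)) ≤ s →
  allotᵖ , encodeℕs bs ∷ encodeℕ t ∷ encodeℕ m ∷ S ∷ [] ⊢ allotᵖ ⇓ allot bs t m S
  ⟨ (1 + length bs) * (16 + (4 * size (encodeℕ B) + (1 + t) * stepCost B s)) ⟩
allotᵖ-runs t m n [] S⊑ h = relax (caseⁿᵇ varᵇ varᵇ)
  (≤-trans (m≤m+n 3 _) (≤-reflexive (sym (*-identityˡ _))))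
allotᵖ-runs {b ∷ bs} t m n {B} {S} {s} (b≤B ∷ bs≤B) S⊑ h = relax
  (case∙ᵇ varᵇ (selfᵇ
    (varᵇ ∷ᵇ varᵇ ∷ᵇ varᵇ ∷ᵇ
     headᵇ (callᵇ
       (varᵇ ∷ᵇ varᵇ ∷ᵇ callᵇ (varᵇ ∷ᵇ varᵇ ∷ᵇ []ᵇ) copiesᵇ ∷ᵇ []ᵇ)
       (iterateᵖ-runs t m n B R⊑ h))
     ∷ᵇ []ᵇ)
    (allotᵖ-runs t m n bs≤B (head-⊑ B (iterate-⊑ t m n B R⊑)) h)))
  (arith (length bs) (4 * size (encodeℕ B)) ((1 + t) * stepCost B s))
  where
  R⊑ : copies b S ⊑ copies B (box m n)
  R⊑ = copies-⊑ b≤B S⊑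
  copiesᵇ : copiesᵖ , encodeℕ b ∷ S ∷ [] ⊢ copiesᵖ ⇓ copies b S ⟨ 4 * size (encodeℕ B) ⟩
  copiesᵇ = relax (copiesᵖ-runs b S) (*-monoʳ-≤ 4 (encodeℕ-size-mono b≤B))
  arith : ∀ l c i → 8 + (5 + (c + 0 + i) + 1 + 0 + (1 + l) * (16 + (c + i))) ≤ (2 + l) * (16 + (c + i))
  arith l c i = ≤-slack 2 (solve (l List.∷ c List.∷ i List.∷ List.[]))

corner : ℕ → Tree → Tree
corner zero    T = T
corner (suc m) T = corner m (head T)

cornerᵖ : Function 2
cornerᵖ = case v₀ v₁ (self (v₁ ∷ case v₃ nil v₀ ∷ []))

cornerᵖ-runs : ∀ m T → cornerᵖ , encodeℕ m ∷ T ∷ [] ⊢ cornerᵖ ⇓ corner m T ⟨ 4 * size (encodeℕ m) ⟩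
cornerᵖ-runs zero    T = relax (caseⁿᵇ varᵇ varᵇ) (n≤1+n 3)
cornerᵖ-runs (suc m) T = relax
  (case∙ᵇ varᵇ (selfᵇ (varᵇ ∷ᵇ headᵇ varᵇ ∷ᵇ []ᵇ) (cornerᵖ-runs m (head T))))
  (arith (size (encodeℕ m)))
  where
  arith : ∀ s → 7 + 4 * s ≤ 4 * (2 + s)
  arith s = ≤-slack 1 (solve (s List.∷ List.[]))

-- The greedy rule for one manipulator

dropFirst : ℕ → List ℕ → List ℕ
dropFirst n []       = []
dropFirst n (b ∷ bs) with n ∸ b
... | zero  = bs
... | suc _ = b ∷ dropFirst n bs

dropFirstᵖ : Function 2
dropFirstᵖ = case v₁ nil (case (call monusᵖ (v₂ ∷ v₀ ∷ [])) v₁ (v₂ ∙ self (v₄ ∷ v₃ ∷ [])))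

dropFirstᵖ-runs : ∀ n bs → dropFirstᵖ , encodeℕ n ∷ encodeℕs bs ∷ [] ⊢ dropFirstᵖ ⇓ encodeℕs (dropFirst n bs)
                  ⟨ 11 * size (encodeℕs bs) ⟩
dropFirstᵖ-runs n [] = relax (caseⁿᵇ varᵇ nilᵇ) (m≤m+n 3 8)
dropFirstᵖ-runs n (b ∷ bs) with n ∸ b | monusᵖ-runs n b
... | zero  | monusᵇ = relax
  (case∙ᵇ varᵇ (caseⁿᵇ (callᵇ (varᵇ ∷ᵇ varᵇ ∷ᵇ []ᵇ) monusᵇ) varᵇ))
  (arith (size (encodeℕ b)) (size (encodeℕs bs)))
  where
  arith : ∀ s t → 6 + (4 * s + 1) ≤ 11 * (1 + (s + t))
  arith s t = ≤-slack (4 + (7 * s + 11 * t)) (solve (s List.∷ t List.∷ List.[]))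
... | suc _ | monusᵇ = relax
  (case∙ᵇ varᵇ (case∙ᵇ (callᵇ (varᵇ ∷ᵇ varᵇ ∷ᵇ []ᵇ) monusᵇ)
    (consᵇ varᵇ (selfᵇ (varᵇ ∷ᵇ varᵇ ∷ᵇ []ᵇ) (dropFirstᵖ-runs n bs)))))
  (arith (size (encodeℕ b)) (size (encodeℕs bs)))
  where
  arith : ∀ s t → 6 + (4 * s + (5 + 11 * t)) ≤ 11 * (1 + (s + t))
  arith s t = ≤-slack (7 * s) (solve (s List.∷ t List.∷ List.[]))

dropFirst-size : ∀ n bs → size (encodeℕs (dropFirst n bs)) ≤ size (encodeℕs bs)
dropFirst-size n [] = ≤-refl
dropFirst-size n (b ∷ bs) with n ∸ b
... | zero  = m≤n⇒m≤1+n (m≤n+m _ (size (encodeℕ b)))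
... | suc _ = s≤s (+-monoʳ-≤ (size (encodeℕ b)) (dropFirst-size n bs))

greedy : ℕ → List ℕ → List ℕ
greedy zero    bs = bs
greedy (suc n) bs = greedy n (dropFirst (suc n) bs)

greedyᵖ : Function 2
greedyᵖ = case v₀ v₁ (self (v₁ ∷ call dropFirstᵖ (v₂ ∷ v₃ ∷ []) ∷ []))

greedyᵖ-runs : ∀ n bs {s} → size (encodeℕs bs) ≤ s →
  greedyᵖ , encodeℕ n ∷ encodeℕs bs ∷ [] ⊢ greedyᵖ ⇓ encodeℕs (greedy n bs) ⟨ (1 + n) * (7 + 11 * s) ⟩
greedyᵖ-runs zero    bs {s} _ = relax (caseⁿᵇ varᵇ varᵇ)
  (≤-trans (m≤m+n 3 _) (≤-reflexive (sym (*-identityˡ (7 + 11 * s)))))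
greedyᵖ-runs (suc n) bs {s} h = relax
  (case∙ᵇ varᵇ (selfᵇ
    (varᵇ ∷ᵇ callᵇ (varᵇ ∷ᵇ varᵇ ∷ᵇ []ᵇ) (relax (dropFirstᵖ-runs (suc n) bs) (*-monoʳ-≤ 11 h)) ∷ᵇ []ᵇ)
    (greedyᵖ-runs n (dropFirst (suc n) bs) (≤-trans (dropFirst-size (suc n) bs) h))))
  (arith n s)
  where
  arith : ∀ n s → 7 + (11 * s + 0 + (1 + n) * (7 + 11 * s)) ≤ (2 + n) * (7 + 11 * s)
  arith n s = ≤-slack 0 (solve (n List.∷ s List.∷ List.[]))

-- Decomposition of regular bipartite multigraphs

sum-mono : ∀ {n} {f g : Vector ℕ n} → (∀ i → f i ≤ g i) → sum f ≤ sum g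
sum-mono {zero}  h = z≤n
sum-mono {suc n} h = +-mono-≤ (h zero) (sum-mono (h ∘ suc))

sum-mono-< : ∀ {n} {f g : Vector ℕ n} → (∀ i → f i ≤ g i) → ∀ i → f i < g i → sum f < sum g
sum-mono-< h zero    lt = +-mono-<-≤ lt (sum-mono (h ∘ suc))
sum-mono-< h (suc i) lt = +-mono-≤-< (h zero) (sum-mono-< (h ∘ suc) i lt)

member≤sum : ∀ {n} (f : Vector ℕ n) i → f i ≤ sum f
member≤sum f zero    = m≤m+n (f zero) _
member≤sum f (suc i) = ≤-trans (member≤sum (f ∘ suc) i) (m≤n+m _ (f zero))

sum-positive : ∀ {n} (f : Vector ℕ n) → 0 < sum f → ∃ λ i → 0 < f i
sum-positive {suc n} f h with f zero in eq
... | suc _ = zero , subst (0 <_) (sym eq) (s≤s z≤n)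
... | zero  with i , lt ← sum-positive (f ∘ suc) h = suc i , lt

-- The Kronecker delta, by recursion so that `bump j v` unfolds along with `look`, one level at a
-- time.
δ : ∀ {n} → Fin n → Fin n → ℕ
δ zero    zero    = 1
δ zero    (suc _) = 0
δ (suc _) zero    = 0
δ (suc i) (suc j) = δ i j

δ-refl : ∀ {n} (i : Fin n) → δ i i ≡ 1
δ-refl zero    = refl
δ-refl (suc i) = δ-refl i

sum-zero : ∀ {n} (f : Vector ℕ n) → (∀ i → f i ≡ 0) → sum f ≡ 0
sum-zero {zero}  f h = refl
sum-zero {suc n} f h = cong₂ _+_ (h zero) (sum-zero (f ∘ suc) (h ∘ suc))

sum-δ-* : ∀ {n} (h : Vector ℕ n) j → sum (λ i → δ i j * h i) ≡ h j
sum-δ-* h zero    = trans (cong₂ _+_ (+-identityʳ (h zero)) (sum-zero (λ i → 0 * h (suc i)) λ _ → refl)) (+-identityʳ (h zero))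
sum-δ-* h (suc j) = sum-δ-* (h ∘ suc) j

-- The augmenting-path method: `f` matches every row but row 0, and a set `V` of rows reached from
-- row 0 by alternating paths grows until such a path ends in a free column.
module Augment {n k T} (X : Fin (suc n) → Fin k → ℕ) (T>0 : 0 < T)
  (rowSum : ∀ r → sum (X r) ≡ T) (colSum : ∀ c → sum (λ r → X r c) ≤ T)
  (f : Fin n → Fin k) (f-injective : Injective _≡_ _≡_ f) where

  weight : Bool → ℕ
  weight b = if b then 1 else 0

  -- Row 0 is the one that f does not match, so it is visited from the start.
  visited⁺ : (Fin n → Bool) → Fin (suc n) → Bool
  visited⁺ V zero    = true
  visited⁺ V (suc i) = V i

  Covered : (Fin n → Bool) → Fin k → Set
  Covered V c = ∃ λ i → V i ≡ true × f i ≡ c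

  covered? : ∀ V c → Dec (Covered V c)
  covered? V c = any? λ i → (V i ≟ᵇ true) ×-dec (f i ≟ c)

  -- Hall's condition by counting: the visited rows, row 0 included, carry weight (|V| + 1) T, while
  -- the columns that `f` gives to `V` hold at most |V| T.
  escape : ∀ V → ∃₂ λ r c → visited⁺ V r ≡ true × ¬ Covered V c × 0 < X r c
  escape V with any? (λ r → any? (λ c → (visited⁺ V r ≟ᵇ true) ×-dec (¬? (covered? V c) ×-dec (0 <? X r c))))
  ... | yes found = found
  ... | no  none  = contradiction (≤-trans (m<m+n covered T>0) (≤-trans (≤-reflexive (+-comm covered T)) closed)) (n≮n covered)
    where
    covered : ℕ
    covered = sum λ i → weight (V i) * T
    -- In a covered column the term of one covering row i already pays for the cell; in any other
    -- column the cell is 0 by `none`.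
    cell : ∀ r c → weight (visited⁺ V r) * X r c ≤ sum λ i → weight (V i) * (weight (visited⁺ V r) * (δ c (f i) * X r c))
    cell r c with visited⁺ V r in v | covered? V c
    ... | false | _ = z≤n
    ... | true  | yes (i , Vi , refl) = ≤-trans (≤-reflexive hit) (member≤sum _ i)
      where
      hit : 1 * X r (f i) ≡ weight (V i) * (1 * (δ (f i) (f i) * X r (f i)))
      hit rewrite Vi | δ-refl (f i) = cong (_+ 0) (sym (trans (+-identityʳ _) (+-identityʳ _)))
    ... | true  | no ¬cov = ≤-trans (≤-reflexive (trans (+-identityʳ _) Xrc≡0)) z≤n
      where
      Xrc≡0 : X r c ≡ 0
      Xrc≡0 = n≤0⇒n≡0 (≮⇒≥ λ lt → none (r , c , v , ¬cov , lt))
    closed : T + covered ≤ covered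
    closed = begin
      T + covered
        ≡⟨ cong (_+ covered) (sym (+-identityʳ T)) ⟩
      sum (λ r → weight (visited⁺ V r) * T)
        ≡⟨ sum-cong-≗ (λ r → trans (cong (weight (visited⁺ V r) *_) (sym (rowSum r))) (*-distribˡ-sum (weight (visited⁺ V r)) (X r))) ⟩
      sum (λ r → sum λ c → weight (visited⁺ V r) * X r c)
        ≤⟨ sum-mono (λ r → sum-mono (cell r)) ⟩
      sum (λ r → sum λ c → sum λ i → weight (V i) * (weight (visited⁺ V r) * (δ c (f i) * X r c)))
        ≡⟨ sum-cong-≗ (λ r → ∑-comm (λ c i → weight (V i) * (weight (visited⁺ V r) * (δ c (f i) * X r c)))) ⟩
      sum (λ r → sum λ i → sum λ c → weight (V i) * (weight (visited⁺ V r) * (δ c (f i) * X r c)))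
        ≡⟨ sum-cong-≗ (λ r → sum-cong-≗ λ i → sym (trans
             (cong (λ x → weight (V i) * (weight (visited⁺ V r) * x)) (sym (sum-δ-* (X r) (f i))))
             (trans (cong (weight (V i) *_) (*-distribˡ-sum (weight (visited⁺ V r)) (λ c → δ c (f i) * X r c)))
                    (*-distribˡ-sum (weight (V i)) (λ c → weight (visited⁺ V r) * (δ c (f i) * X r c)))))) ⟩
      sum (λ r → sum λ i → weight (V i) * (weight (visited⁺ V r) * X r (f i)))
        ≡⟨ ∑-comm (λ r i → weight (V i) * (weight (visited⁺ V r) * X r (f i))) ⟩
      sum (λ i → sum λ r → weight (V i) * (weight (visited⁺ V r) * X r (f i)))
        ≤⟨ sum-mono (λ i → sum-mono λ r → *-monoʳ-≤ (weight (V i)) (weight-≤ (visited⁺ V r) (X r (f i)))) ⟩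
      sum (λ i → sum λ r → weight (V i) * X r (f i))
        ≡⟨ sum-cong-≗ (λ i → sym (*-distribˡ-sum (weight (V i)) (λ r → X r (f i)))) ⟩
      sum (λ i → weight (V i) * sum (λ r → X r (f i)))
        ≤⟨ sum-mono (λ i → *-monoʳ-≤ (weight (V i)) (colSum (f i))) ⟩
      covered ∎
      where
      open ≤-Reasoning
      weight-≤ : ∀ b x → weight b * x ≤ x
      weight-≤ false x = z≤n
      weight-≤ true  x = ≤-reflexive (+-identityʳ x)

  Matches : (Fin (suc n) → Set) → (Fin (suc n) → Fin k) → Set
  Matches D g = (∀ i → D i → 0 < X i (g i)) × (∀ i j → D i → D j → g i ≡ g j → i ≡ j)

  -- A matching of all rows but r that agrees with f on the unvisited rows and
  -- uses only covered columns on the visited ones.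
  record Exchange (V : Fin n → Bool) (r : Fin (suc n)) : Set where
    field
      g       : Fin (suc n) → Fin k
      matches : Matches (_≢ r) g
      outside : ∀ i → V i ≡ false → g (suc i) ≡ f i
      inside  : ∀ i → visited⁺ V i ≡ true → i ≢ r → Covered V (g i)

  unvisited : (Fin n → Bool) → ℕ
  unvisited V = sum λ i → if V i then 0 else 1

  visit : (Fin n → Bool) → Fin n → Fin n → Bool
  visit V i = updateAt V i (const true)

  visit-mono : ∀ V i j → V j ≡ true → visit V i j ≡ true
  visit-mono V i j Vj with j ≟ i
  ... | yes refl = updateAt-updates i V
  ... | no  j≢i  = trans (updateAt-minimal j i V j≢i) Vj

  visit-false : ∀ V i j → visit V i j ≡ false → V j ≡ false
  visit-false V i j eq with V j in Vj
  ... | false = refl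
  ... | true  = trans (sym (visit-mono V i j Vj)) eq

  visit⁻ : ∀ V i j → visit V i j ≡ true → j ≢ i → V j ≡ true
  visit⁻ V i j eq j≢i = trans (sym (updateAt-minimal j i V j≢i)) eq

  visit-unvisited : ∀ V i → V i ≡ false → unvisited (visit V i) < unvisited V
  visit-unvisited V i Vi = sum-mono-< le i lt
    where
    le : ∀ j → (if visit V i j then 0 else 1) ≤ (if V j then 0 else 1)
    le j with visit V i j in eq
    ... | true  = z≤n
    ... | false rewrite visit-false V i j eq = ≤-refl
    lt : (if visit V i i then 0 else 1) < (if V i then 0 else 1)
    lt rewrite updateAt-updates i {const true} V | Vi = s≤s z≤n

  covered-mono : ∀ V i {c} → Covered V c → Covered (visit V i) c
  covered-mono V i (j , Vj , fj) = j , visit-mono V i j Vj , fj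

  exchange-mono : ∀ V i {r} → V i ≡ false → Exchange V r → Exchange (visit V i) r
  exchange-mono V i {r} Vi e = record
    { g       = g
    ; matches = matches
    ; outside = λ j eq → outside j (visit-false V i j eq)
    ; inside  = inside′
    }
    where
    open Exchange e
    inside′ : ∀ j → visited⁺ (visit V i) j ≡ true → j ≢ r → Covered (visit V i) (g j)
    inside′ zero    v j≢r = covered-mono V i (inside zero v j≢r)
    inside′ (suc j) v j≢r with j ≟ i
    -- The newly visited row still has its old column, which it now covers itself.
    ... | yes refl = j , updateAt-updates j V , sym (outside j Vi)
    ... | no  j≢i  = covered-mono V i (inside (suc j) (visit⁻ V i j v j≢i) j≢r)

  -- The freed row r takes the new column c. Either this completes the matching, or c belongs to an
  -- unvisited row, which becomes the freed row in turn.
  module Extend V r c (Vr : visited⁺ V r ≡ true) (¬cov : ¬ Covered V c) (Xrc : 0 < X r c) (e : Exchange V r) where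
    open Exchange e

    g′ : Fin (suc n) → Fin k
    g′ = updateAt g r (const c)

    -- Visited rows other than r use covered columns only, and c is not covered; so a competitor for
    -- c is unvisited and still has its column from `f`.
    clash : ∀ j → j ≢ r → g j ≡ c → ∃ λ j′ → j ≡ suc j′ × V j′ ≡ false × f j′ ≡ c
    clash j j≢r eq with visited⁺ V j in v
    clash j       j≢r refl | true  = contradiction (inside j v j≢r) ¬cov
    clash (suc j) j≢r eq   | false = j , refl , v , trans (sym (outside j v)) eq

    extend : ∀ {D : Fin (suc n) → Set} → (∀ j → D (suc j) → V j ≡ false → f j ≢ c) → Matches D g′
    extend {D} fresh = positive , injective
      where
      positive : ∀ i → D i → 0 < X i (g′ i)
      positive i _ with i ≟ r
      ... | yes refl rewrite updateAt-updates i {const c} g = Xrc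
      ... | no  i≢r  rewrite updateAt-minimal i r {const c} g i≢r = proj₁ matches i i≢r
      avoids : ∀ j → D j → j ≢ r → g j ≢ c
      avoids j Dj j≢r eq with j′ , refl , Vj , fj ← clash j j≢r eq = fresh j′ Dj Vj fj
      injective : ∀ i j → D i → D j → g′ i ≡ g′ j → i ≡ j
      injective i j Di Dj eq with i ≟ r | j ≟ r
      ... | yes refl | yes refl = refl
      ... | yes refl | no j≢r   = contradiction
        (trans (sym (updateAt-minimal j r g j≢r)) (trans (sym eq) (updateAt-updates r g))) (avoids j Dj j≢r)
      ... | no i≢r   | yes refl = contradiction
        (trans (sym (updateAt-minimal i r g i≢r)) (trans eq (updateAt-updates r g))) (avoids i Di i≢r)
      ... | no i≢r   | no j≢r   = proj₂ matches i j i≢r j≢r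
        (trans (sym (updateAt-minimal i r g i≢r)) (trans eq (updateAt-minimal j r g j≢r)))

    -- The alternating path is prolonged to row i. By injectivity of `f`, row i is the only
    -- competitor for c, so freeing it restores a matching of the others.
    shift : ∀ i → V i ≡ false → f i ≡ c → Exchange (visit V i) (suc i)
    shift i Vi fi = record
      { g       = g′
      ; matches = extend λ j j≢i _ fj → j≢i (cong suc (f-injective (trans fj (sym fi))))
      ; outside = λ j v → trans (updateAt-minimal (suc j) r g (unvisited≢r j (visit-false V i j v))) (outside j (visit-false V i j v))
      ; inside  = inside′
      }
      where
      unvisited≢r : ∀ j → V j ≡ false → suc j ≢ r
      unvisited≢r j Vj refl with () ← trans (sym Vj) Vr
      old : ∀ j → visited⁺ (visit V i) j ≡ true → j ≢ suc i → visited⁺ V j ≡ true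
      old zero    _ _   = refl
      old (suc j) v j≢i = visit⁻ V i j v (j≢i ∘ cong suc)
      inside′ : ∀ j → visited⁺ (visit V i) j ≡ true → j ≢ suc i → Covered (visit V i) (g′ j)
      inside′ j v j≢i with j ≟ r
      ... | yes refl = i , updateAt-updates i V , trans fi (sym (updateAt-updates j g))
      ... | no  j≢r  = subst (Covered (visit V i)) (sym (updateAt-minimal j r g j≢r))
                         (covered-mono V i (inside j (old j v j≢i) j≢r))

  -- Each failed round visits a new row, so the number of unvisited rows bounds the number of
  -- rounds.
  search : ∀ fuel V → unvisited V ≤ fuel → (∀ r → visited⁺ V r ≡ true → Exchange V r) →
           ∃ λ g → Matches (λ _ → ⊤) g
  search fuel V le exchange with escape V
  ... | r , c , Vr , ¬cov , Xrc with any? (λ i → (V i ≟ᵇ false) ×-dec (f i ≟ c))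
  ...   | no  none = g′ , extend λ j _ Vj fj → none (j , Vj , fj)
    where open Extend V r c Vr ¬cov Xrc (exchange r Vr)
  ...   | yes (i , Vi , fi) with fuel
  ...     | zero      = contradiction (≤-trans (visit-unvisited V i Vi) le) λ ()
  ...     | suc fuel′ = search fuel′ (visit V i) (≤-pred (≤-trans (visit-unvisited V i Vi) le)) exchange′
    where
    open Extend V r c Vr ¬cov Xrc (exchange r Vr)
    exchange′ : ∀ j → visited⁺ (visit V i) j ≡ true → Exchange (visit V i) j
    exchange′ zero    v = exchange-mono V i Vi (exchange zero refl)
    exchange′ (suc j) v with j ≟ i
    ... | yes refl = shift j Vi fi
    ... | no  j≢i  = exchange-mono V i Vi (exchange (suc j) (visit⁻ V i j v j≢i))

-- Induction on the rows. Deleting a row keeps the row sums but lowers column sums, hence the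
-- inequality for columns.
matching : ∀ {n k T} (X : Fin n → Fin k → ℕ) → 0 < T →
           (∀ r → sum (X r) ≡ T) → (∀ c → sum (λ r → X r c) ≤ T) →
           ∃ λ (f : Fin n → Fin k) → (∀ i → 0 < X i (f i)) × Injective _≡_ _≡_ f
matching {zero}  X T>0 rowSum colSum = (λ ()) , (λ ()) , λ { {()} }
matching {suc n} {k} X T>0 rowSum colSum
  with f , positive , f-injective ← matching (X ∘ suc) T>0 (rowSum ∘ suc)
         (λ c → ≤-trans (m≤n+m _ (X zero c)) (colSum c))
  -- A placeholder for row 0 in the initial exchange, where row 0 is the freed row; the positive row
  -- sum shows that a column exists.
  with c , _ ← sum-positive (X zero) (subst (0 <_) (sym (rowSum zero)) T>0)
  = finish
  where
  open Augment X T>0 rowSum colSum f f-injective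

  start : ∀ r → visited⁺ (const false) r ≡ true → Exchange (const false) r
  start zero _ = record
    { g       = λ { zero → c ; (suc i) → f i }
    ; matches = (λ { zero 0≢0 → contradiction refl 0≢0 ; (suc i) _ → positive i })
              , λ { zero _ 0≢0 _ _ → contradiction refl 0≢0
                  ; (suc _) zero _ 0≢0 _ → contradiction refl 0≢0
                  ; (suc i) (suc j) _ _ eq → cong suc (f-injective eq) }
    ; outside = λ _ _ → refl
    ; inside  = λ { zero _ 0≢0 → contradiction refl 0≢0 ; (suc _) () }
    }

  finish : ∃ λ (f : Fin (suc n) → Fin k) → (∀ i → 0 < X i (f i)) × Injective _≡_ _≡_ f
  finish with g , pos , inj ← search (unvisited (const false)) (const false) ≤-refl start =
    g , (λ i → pos i tt) , λ {i} {j} → inj i j tt tt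

injective⇒surjective : ∀ {n} {f : Fin n → Fin n} → Injective _≡_ _≡_ f → ∀ y → ∃ λ x → f x ≡ y
injective⇒surjective {suc n} {f} f-injective y with any? (λ x → f x ≟ y)
... | yes found = found
... | no  none  = contradiction
  (injective⇒≤ {f = λ x → punchOut (missed x)} (λ {i} {j} eq → f-injective (punchOut-injective (missed i) (missed j) eq)))
  (n≮n n)
  where
  missed : ∀ x → y ≢ f x
  missed x y≡fx = none (x , sym y≡fx)

injective⇒permutation : ∀ {n} {f : Fin n → Fin n} → Injective _≡_ _≡_ f →
                        ∃ λ (π : Permutation′ n) → ∀ i → π ⟨$⟩ʳ i ≡ f i
injective⇒permutation {f = f} f-injective =
  permutation f (proj₁ ∘ surj) (proj₂ ∘ surj) (λ x → f-injective (proj₂ (surj (f x)))) , λ _ → refl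
  where
  surj = injective⇒surjective f-injective

occurrences : ∀ {m t} → Fin m → Vec (Fin m) t → ℕ
occurrences j []      = 0
occurrences j (x ∷ w) = δ j x + occurrences j w

total : ∀ {m t} → Vec (Fin m) t → ℕ
total []      = 0
total (x ∷ w) = toℕ x + total w

sum-δ : ∀ {n} (j : Fin n) → sum (λ i → δ i j) ≡ 1
sum-δ j = trans (sum-cong-≗ (λ i → sym (*-identityʳ (δ i j)))) (sum-δ-* (const 1) j)

sum-occurrences : ∀ {m t} (w : Vec (Fin m) t) → sum (λ j → occurrences j w) ≡ t
sum-occurrences {m} []      = sum-zero {m} (λ _ → 0) (λ _ → refl)
sum-occurrences (x ∷ w) = trans (∑-distrib-+ (λ j → δ j x) (λ j → occurrences j w))
  (cong₂ _+_ (sum-δ x) (sum-occurrences w))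

δ-positive : ∀ {n} (i j : Fin n) → 0 < δ i j → i ≡ j
δ-positive zero    zero    _ = refl
δ-positive (suc i) (suc j) h = cong suc (δ-positive i j h)

removeOccurrence : ∀ {m t} (w : Vec (Fin m) (suc t)) j → 0 < occurrences j w →
  ∃ λ (w′ : Vec (Fin m) t) → (∀ i → occurrences i w ≡ δ i j + occurrences i w′) × total w ≡ toℕ j + total w′
removeOccurrence (x ∷ w) j h with j ≟ x
... | yes refl = w , (λ _ → refl) , refl
removeOccurrence (x ∷ []) j h | no j≢x = contradiction (δ-positive j x (subst (0 <_) (+-identityʳ _) h)) j≢x
removeOccurrence (x ∷ w@(_ ∷ _)) j h | no j≢x with δ j x in eq
... | suc _ = contradiction (δ-positive j x (subst (0 <_) (sym eq) (s≤s z≤n))) j≢x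
... | zero  with w′ , occ , tot ← removeOccurrence w j h =
  x ∷ w′
  , (λ i → trans (cong (δ i x +_) (occ i)) (swap (δ i x) (δ i j) _))
  , trans (cong (toℕ x +_) tot) (swap (toℕ x) (toℕ j) _)
  where
  swap : ∀ a b c → a + (b + c) ≡ b + (a + c)
  swap a b c = trans (sym (+-assoc a b c)) (trans (cong (_+ c) (+-comm a b)) (+-assoc b a c))

scores : ∀ {m t} → Vec (Permutation′ m) t → Fin m → Vec (Fin m) t
scores πs c = Vec.map (_⟨$⟩ʳ c) πs

-- Score counts form a matrix with row sums t, and each perfect matching in its support is split off
-- as one vote. Votes may permute the scores within a row, but only totals matter.
decompose : ∀ {m t} (rows : Fin m → Vec (Fin m) t) → (∀ j → sum (λ c → occurrences j (rows c)) ≤ t) →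
            ∃ λ (πs : Vec (Permutation′ m) t) → ∀ c → total (scores πs c) ≡ total (rows c)
decompose {t = zero}  rows balanced = [] , λ c → lemma (rows c)
  where
  lemma : ∀ {m} (w : Vec (Fin m) 0) → 0 ≡ total w
  lemma [] = refl
decompose {m} {suc t} rows balanced
  with f , positive , f-injective ← matching (λ c j → occurrences j (rows c)) (s≤s z≤n) (sum-occurrences ∘ rows) balanced
  with π , π≡f ← injective⇒permutation f-injective = combine (decompose rows′ balanced′)
  where
  removed : ∀ c → _
  removed c = removeOccurrence (rows c) (f c) (positive c)
  rows′ : Fin m → Vec (Fin m) t
  rows′ = proj₁ ∘ removed
  balanced′ : ∀ j → sum (λ c → occurrences j (rows′ c)) ≤ t
  -- Being injective on a finite set, `f` is onto, so every score loses an occurrence and its column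
  -- bound drops by one.
  balanced′ j with c₀ , fc₀ ← injective⇒surjective f-injective j = ≤-pred (begin
    suc (sum (λ c → occurrences j (rows′ c)))
      ≤⟨ +-monoˡ-≤ _ (≤-trans (≤-reflexive (sym (trans (cong (δ j) fc₀) (δ-refl j)))) (member≤sum (λ c → δ j (f c)) c₀)) ⟩
    sum (λ c → δ j (f c)) + sum (λ c → occurrences j (rows′ c))
      ≡⟨ ∑-distrib-+ (λ c → δ j (f c)) (λ c → occurrences j (rows′ c)) ⟨
    sum (λ c → δ j (f c) + occurrences j (rows′ c))
      ≡⟨ sum-cong-≗ (λ c → proj₁ (proj₂ (removed c)) j) ⟨
    sum (λ c → occurrences j (rows c))
      ≤⟨ balanced j ⟩
    suc t ∎)
    where open ≤-Reasoning
  combine : (∃ λ πs → ∀ c → total (scores πs c) ≡ total (rows′ c)) →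
            ∃ λ πs → ∀ c → total (scores πs c) ≡ total (rows c)
  combine (πs , eq) = π ∷ πs , λ c →
    trans (cong₂ (λ x y → toℕ x + y) (π≡f c) (eq c)) (sym (proj₂ (proj₂ (removed c))))

-- The tries compute the deals

Occupied : Tree → Set
Occupied nil     = ⊥
Occupied (_ ∙ _) = ⊤

nth : Tree → ℕ → Tree
nth nil     _       = nil
nth (a ∙ b) zero    = a
nth (a ∙ b) (suc i) = nth b i

look : ∀ {n} → Tree → (Fin n → ℕ) → Tree
look {zero}  T v = T
look {suc n} T v = look (nth T (v zero)) (v ∘ suc)

infix 4 _∋_

_∋_ : ∀ {n} → Tree → (Fin n → ℕ) → Set
T ∋ v = Occupied (look T v)

look-nil : ∀ {n} (v : Fin n → ℕ) → look nil v ≡ nil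
look-nil {zero}  v = refl
look-nil {suc n} v = look-nil (v ∘ suc)

nil∌ : ∀ {n} (v : Fin n → ℕ) → ¬ nil ∋ v
nil∌ v h = subst Occupied (look-nil v) h

union-nilʳ : ∀ x → union x nil ≡ x
union-nilʳ nil     = refl
union-nilʳ (_ ∙ _) = refl

nth-union : ∀ x y i → nth (union x y) i ≡ union (nth x i) (nth y i)
nth-union nil     y       i       = refl
nth-union (a ∙ b) nil     i       = sym (union-nilʳ (nth (a ∙ b) i))
nth-union (a ∙ b) (c ∙ d) zero    = refl
nth-union (a ∙ b) (c ∙ d) (suc i) = nth-union b d i

look-union : ∀ {n} x y (v : Fin n → ℕ) → look (union x y) v ≡ union (look x v) (look y v)
look-union {zero}  x y v = refl
look-union {suc n} x y v = trans (cong (λ T → look T (v ∘ suc)) (nth-union x y (v zero)))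
                                 (look-union (nth x (v zero)) (nth y (v zero)) (v ∘ suc))

occupied-union⁺ : ∀ x y → Occupied x ⊎ Occupied y → Occupied (union x y)
occupied-union⁺ nil     y       (inj₂ h) = h
occupied-union⁺ (_ ∙ _) nil     _        = tt
occupied-union⁺ (_ ∙ _) (_ ∙ _) _        = tt

occupied-union⁻ : ∀ x y → Occupied (union x y) → Occupied x ⊎ Occupied y
occupied-union⁻ nil     y h = inj₂ h
occupied-union⁻ (_ ∙ _) y h = inj₁ tt

bump : ∀ {n} → Fin n → (Fin n → ℕ) → Fin n → ℕ
bump j v i = δ i j + v i

nth-lower-zero : ∀ T i → nth (lower 0 T) i ≡ nth T (suc i)
nth-lower-zero nil     i = refl
nth-lower-zero (_ ∙ _) i = refl

nth-lower-suc : ∀ j T i → nth (lower (suc j) T) i ≡ lower j (nth T i)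
nth-lower-suc j nil     i       = refl
nth-lower-suc j (_ ∙ _) zero    = refl
nth-lower-suc j (_ ∙ b) (suc i) = nth-lower-suc j b i

look-lower : ∀ {n} (j : Fin n) T v → look (lower (toℕ j) T) v ≡ look T (bump j v)
look-lower zero    T v = cong (λ S → look S (v ∘ suc)) (nth-lower-zero T (v zero))
look-lower (suc j) T v = trans (cong (λ S → look S (v ∘ suc)) (nth-lower-suc (toℕ j) T (v zero)))
                               (look-lower j (nth T (v zero)) (v ∘ suc))

-- Stated for any starting score a, since `draw` raises it while walking down the list.
draw⁺ : ∀ {n} a k R (j : Fin n) i v → toℕ j ≡ a + i → i < k → nth R i ∋ bump j v → draw a k R ∋ v
draw⁺ a (suc k) nil     j i v eq i<k h = contradiction h (nil∌ (bump j v))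
draw⁺ a (suc k) (S ∙ R) j i v eq i<k h =
  subst Occupied (sym (look-union (lower a S) (draw (suc a) k R) v)) (occupied-union⁺ (look (lower a S) v) _ (side i eq i<k h))
  where
  side : ∀ i → toℕ j ≡ a + i → i < suc k → nth (S ∙ R) i ∋ bump j v → lower a S ∋ v ⊎ draw (suc a) k R ∋ v
  side zero    eq _         h = inj₁ (subst (λ a → lower a S ∋ v) (trans eq (+-identityʳ a))
                                  (subst Occupied (sym (look-lower j S v)) h))
  side (suc i) eq (s≤s i<k) h = inj₂ (draw⁺ (suc a) k R j i v (trans eq (+-suc a i)) i<k h)

draw⁻ : ∀ {n} a k R v → a + k ≡ n → draw a k R ∋ v → ∃₂ λ (j : Fin n) i → toℕ j ≡ a + i × nth R i ∋ bump j v
draw⁻ a zero    R       v _  h = contradiction h (nil∌ v)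
draw⁻ a (suc k) nil     v _  h = contradiction h (nil∌ v)
draw⁻ {n} a (suc k) (S ∙ R) v eq h
  with occupied-union⁻ (look (lower a S) v) _ (subst Occupied (look-union (lower a S) (draw (suc a) k R) v) h)
... | inj₁ h₁ = fromℕ< a<n , 0 , trans (toℕ-fromℕ< a<n) (sym (+-identityʳ a))
              , subst Occupied (look-lower (fromℕ< a<n) S v) (subst (λ a → lower a S ∋ v) (sym (toℕ-fromℕ< a<n)) h₁)
  where
  a<n : a < n
  a<n = subst (a <_) eq (m<m+n a (s≤s z≤n))
... | inj₂ h₂ with j , i , eq′ , h′ ← draw⁻ (suc a) k R v (trans (sym (+-suc a k)) eq) h₂ =
  j , suc i , trans eq′ (sym (+-suc a i)) , h′

step⁺ : ∀ {m} R i (j : Fin m) v → nth R (i + toℕ j) ∋ bump j v → nth (step m R) i ∋ v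
step⁺ nil     i       j v h = contradiction h (nil∌ (bump j v))
step⁺ (S ∙ R) zero    j v h = draw⁺ 0 _ (S ∙ R) j (toℕ j) v refl (toℕ<n j) h
step⁺ (S ∙ R) (suc i) j v h = step⁺ R i j v h

step⁻ : ∀ {m} R i v → nth (step m R) i ∋ v → ∃ λ (j : Fin m) → nth R (i + toℕ j) ∋ bump j v
step⁻ nil     i       v h = contradiction h (nil∌ v)
step⁻ (S ∙ R) zero    v h with j , i , refl , h′ ← draw⁻ 0 _ (S ∙ R) v refl h = j , h′
step⁻ (S ∙ R) (suc i) v h = step⁻ R i v h

addRow : ∀ {m t} → Vec (Fin m) t → (Fin m → ℕ) → Fin m → ℕ
addRow []      v = v
addRow (j ∷ w) v = bump j (addRow w v)

total-∷ : ∀ {m t} i (j : Fin m) (w : Vec (Fin m) t) → i + total w + toℕ j ≡ i + total (j ∷ w)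
total-∷ i j w = trans (+-assoc i (total w) (toℕ j)) (cong (i +_) (+-comm (total w) (toℕ j)))

iterate⁺ : ∀ {m} t R i (w : Vec (Fin m) t) v → nth R (i + total w) ∋ addRow w v → nth (iterate t m R) i ∋ v
iterate⁺ zero    R i []      v h = subst (λ i → nth R i ∋ v) (+-identityʳ i) h
iterate⁺ (suc t) R i (j ∷ w) v h = iterate⁺ t (step _ R) i w v
  (step⁺ R (i + total w) j (addRow w v) (subst (λ i → nth R i ∋ addRow (j ∷ w) v) (sym (total-∷ i j w)) h))

iterate⁻ : ∀ {m} t R i v → nth (iterate t m R) i ∋ v → ∃ λ (w : Vec (Fin m) t) → nth R (i + total w) ∋ addRow w v
iterate⁻ zero    R i v h = [] , subst (λ i → nth R i ∋ v) (sym (+-identityʳ i)) h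
iterate⁻ (suc t) R i v h
  with w , h₁ ← iterate⁻ t (step _ R) i v h
  with j , h₂ ← step⁻ R (i + total w) (addRow w v) h₁ =
  j ∷ w , subst (λ i → nth R i ∋ addRow (j ∷ w) v) (total-∷ i j w) h₂

copies⁺ : ∀ {m} (v : Fin m → ℕ) S {n i} → i < n → S ∋ v → nth (copies n S) i ∋ v
copies⁺ v S {i = zero}  (s≤s _)   h = h
copies⁺ v S {i = suc i} (s≤s i<n) h = copies⁺ v S i<n h

copies⁻ : ∀ {m} (v : Fin m → ℕ) n {S} i → nth (copies n S) i ∋ v → i < n × S ∋ v
copies⁻ v zero    i       h = contradiction h (nil∌ v)
copies⁻ v (suc n) zero    h = s≤s z≤n , h
copies⁻ v (suc n) (suc i) h with i<n , h′ ← copies⁻ v n i h = s≤s i<n , h′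

head≡nth : ∀ T → head T ≡ nth T 0
head≡nth nil     = refl
head≡nth (_ ∙ _) = refl

addRows : ∀ {n m t} → (Fin n → Vec (Fin m) t) → (Fin m → ℕ) → Fin m → ℕ
addRows {zero}  rows v = v
addRows {suc n} rows v = addRow (rows zero) (addRows (rows ∘ suc) v)

allot⁺ : ∀ {n m t} (b : Fin n → ℕ) S (rows : Fin n → Vec (Fin m) t) v →
         (∀ c → total (rows c) < b c) → S ∋ addRows rows v → allot (tabulate b) t m S ∋ v
allot⁺ {zero}          b S rows v fits h = h
allot⁺ {suc n} {m} {t} b S rows v fits h = allot⁺ (b ∘ suc) _ (rows ∘ suc) v (fits ∘ suc)
  (subst (_∋ addRows (rows ∘ suc) v) (sym (head≡nth (iterate t m (copies (b zero) S))))
    (iterate⁺ t _ 0 (rows zero) _ (copies⁺ (addRows rows v) S (fits zero) h)))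

allot⁻ : ∀ {n m t} (b : Fin n → ℕ) S v → allot (tabulate b) t m S ∋ v →
         ∃ λ (rows : Fin n → Vec (Fin m) t) → (∀ c → total (rows c) < b c) × S ∋ addRows rows v
allot⁻ {zero}          b S v h = (λ ()) , (λ ()) , h
allot⁻ {suc n} {m} {t} b S v h
  with rows , fits , h₁ ← allot⁻ (b ∘ suc) _ v h
  with w , h₂ ← iterate⁻ t (copies (b zero) S) 0 (addRows rows v)
                  (subst (_∋ addRows rows v) (head≡nth (iterate t m (copies (b zero) S))) h₁)
  with fits₀ , h₃ ← copies⁻ (addRow w (addRows rows v)) (b zero) (total w) h₂ =
  (λ { zero → w ; (suc c) → rows c }) , (λ { zero → fits₀ ; (suc c) → fits c }) , h₃

box⁺ : ∀ {m} n (v : Fin m → ℕ) → (∀ j → v j < n) → box m n ∋ v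
box⁺ {zero}  n v h = tt
box⁺ {suc m} n v h = copies⁺ (v ∘ suc) (box m n) (h zero) (box⁺ n (v ∘ suc) (h ∘ suc))

box⁻ : ∀ {m} n (v : Fin m → ℕ) → box m n ∋ v → ∀ j → v j < n
box⁻ {suc m} n v h with h₁ , h₂ ← copies⁻ (v ∘ suc) n (v zero) h = λ
  { zero → h₁ ; (suc j) → box⁻ n (v ∘ suc) h₂ j }

addRow-value : ∀ {m t} (w : Vec (Fin m) t) v j → addRow w v j ≡ occurrences j w + v j
addRow-value []      v j = refl
addRow-value (x ∷ w) v j = trans (cong (δ j x +_) (addRow-value w v j)) (sym (+-assoc (δ j x) _ _))

addRows-value : ∀ {n m t} (rows : Fin n → Vec (Fin m) t) v j →
                addRows rows v j ≡ sum (λ c → occurrences j (rows c)) + v j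
addRows-value {zero}  rows v j = refl
addRows-value {suc n} rows v j = trans (addRow-value (rows zero) _ j)
  (trans (cong (occurrences j (rows zero) +_) (addRows-value (rows ∘ suc) v j))
         (sym (+-assoc (occurrences j (rows zero)) _ _)))

corner≡look : ∀ m T → corner m T ≡ look {m} T (const 0)
corner≡look zero    T = refl
corner≡look (suc m) T = trans (corner≡look m (head T)) (cong (λ S → look {m} S (const 0)) (head≡nth T))

Fits : ∀ m → ℕ → (Fin m → ℕ) → Set
Fits m t b = ∃ λ (πs : Vec (Permutation′ m) t) → ∀ c → total (scores πs c) < b c

-- The start is the set of all supplies with at most t copies of each score, and the answer is read
-- off at the empty supply.
allotment : ∀ m → ℕ → List ℕ → Tree
allotment m t bs = corner m (allot bs t m (box m (suc t)))

δ-sym : ∀ {n} (i j : Fin n) → δ i j ≡ δ j i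
δ-sym zero    zero    = refl
δ-sym zero    (suc j) = refl
δ-sym (suc i) zero    = refl
δ-sym (suc i) (suc j) = δ-sym i j

scores-balanced : ∀ {m t} (πs : Vec (Permutation′ m) t) j → sum (λ c → occurrences j (scores πs c)) ≡ t
scores-balanced {m} [] j = sum-zero {m} (λ _ → 0) (λ _ → refl)
scores-balanced (π ∷ πs) j = trans (∑-distrib-+ (λ c → δ j (π ⟨$⟩ʳ c)) (λ c → occurrences j (scores πs c)))
  (cong₂ _+_ (trans (sym (sum-permute (δ j) π)) (trans (sum-cong-≗ (δ-sym j)) (sum-δ j))) (scores-balanced πs j))

allotment⁺ : ∀ {m t} b → Fits m t b → Occupied (allotment m t (tabulate b))
allotment⁺ {m} {t} b (πs , fits) = subst Occupied (sym (corner≡look m (allot (tabulate b) t m (box m (suc t)))))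
  (allot⁺ b (box m (suc t)) (scores πs) (const 0) fits (box⁺ (suc t) _ λ j →
    s≤s (≤-reflexive (trans (addRows-value (scores πs) (const 0) j) (trans (+-identityʳ _) (scores-balanced πs j))))))

allotment⁻ : ∀ {m t} b → Occupied (allotment m t (tabulate b)) → Fits m t b
allotment⁻ {m} {t} b h
  with rows , fits , full ← allot⁻ b (box m (suc t)) (const 0)
         (subst Occupied (corner≡look m (allot (tabulate b) t m (box m (suc t)))) h)
  with πs , eq ← decompose rows (λ j → ≤-trans
         (≤-reflexive (sym (trans (addRows-value rows (const 0) j) (+-identityʳ _))))
         (≤-pred (box⁻ (suc t) (addRows rows (const 0)) full j))) =
  πs , λ c → subst (_< b c) (sym (eq c)) (fits c)

corner-⊑ : ∀ m n {T} → T ⊑ box m n → corner m T ⊑ nil ∙ nil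
corner-⊑ zero    n T⊑ = T⊑
corner-⊑ (suc m) n T⊑ = corner-⊑ m n (head-⊑ n T⊑)

allotment-⊑ : ∀ m t bs → allotment m t bs ⊑ nil ∙ nil
allotment-⊑ m t bs = corner-⊑ m (suc t) (allot-⊑ bs t m (suc t) ⊑-refl)

-- One manipulator

dropFirst-spec : ∀ {k} n (b : Fin (suc k) → ℕ) →
  (∃ λ c → n ≤ b c × dropFirst n (tabulate b) ≡ tabulate (b ∘ punchIn c)) ⊎
  ((∀ c → b c < n) × dropFirst n (tabulate b) ≡ tabulate b)
dropFirst-spec {k} n b with n ∸ b zero in eq
... | zero = inj₁ (zero , m∸n≡0⇒m≤n eq , refl)
dropFirst-spec {zero} n b | suc _ =
  inj₂ ((λ { zero → m∸n≢0⇒n<m (λ eq′ → 0≢1+n (trans (sym eq′) eq)) }) , refl)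
dropFirst-spec {suc k} n b | suc _ with dropFirst-spec n (b ∘ suc)
... | inj₁ (c , n≤bc , dropped)  = inj₁ (suc c , n≤bc , cong (b zero ∷_) dropped)
... | inj₂ (below , same) =
  inj₂ ((λ { zero → m∸n≢0⇒n<m (λ eq′ → 0≢1+n (trans (sym eq′) eq)) ; (suc c) → below c }) , cong (b zero ∷_) same)

dropFirst-length : ∀ n bs → length bs ≤ suc (length (dropFirst n bs))
dropFirst-length n [] = z≤n
dropFirst-length n (b ∷ bs) with n ∸ b
... | zero  = ≤-refl
... | suc _ = s≤s (dropFirst-length n bs)

greedy-length : ∀ n bs → length bs ≤ n + length (greedy n bs)
greedy-length zero    bs = ≤-refl
greedy-length (suc n) bs = ≤-trans (dropFirst-length (suc n) bs) (s≤s (greedy-length n (dropFirst (suc n) bs)))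

Assignable : ∀ n → (Fin n → ℕ) → Set
Assignable n b = ∃ λ (π : Permutation′ n) → ∀ c → toℕ (π ⟨$⟩ʳ c) < b c

toℕ-punchIn-≥ : ∀ {n} i (j : Fin n) → toℕ j ≤ toℕ (punchIn i j)
toℕ-punchIn-≥ zero    j       = n≤1+n (toℕ j)
toℕ-punchIn-≥ (suc i) zero    = z≤n
toℕ-punchIn-≥ (suc i) (suc j) = s≤s (toℕ-punchIn-≥ i j)

-- Those ranked above i move down by one and nobody moves up. This serves both for striking p from a
-- manipulator's vote and for the greedy exchange.
remove-≤ : ∀ {n} i (π : Permutation′ (suc n)) c → toℕ (Perm.remove i π ⟨$⟩ʳ c) ≤ toℕ (π ⟨$⟩ʳ punchIn i c)
remove-≤ i π c = subst (λ x → toℕ (Perm.remove i π ⟨$⟩ʳ c) ≤ toℕ x) (sym (Perm.punchIn-permute π i c))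
                   (toℕ-punchIn-≥ (π ⟨$⟩ʳ i) (Perm.remove i π ⟨$⟩ʳ c))

toℕ-punchIn-top : ∀ n (j : Fin n) → toℕ (punchIn (fromℕ n) j) ≡ toℕ j
toℕ-punchIn-top (suc n) zero    = refl
toℕ-punchIn-top (suc n) (suc j) = cong suc (toℕ-punchIn-top n j)

-- Nobody is ranked above the inserted candidate, so nobody shifts.
insert-top : ∀ {n} i (π : Permutation′ n) c → toℕ (Perm.insert i (fromℕ n) π ⟨$⟩ʳ punchIn i c) ≡ toℕ (π ⟨$⟩ʳ c)
insert-top {n} i π c = trans (cong toℕ (Perm.insert-punchIn i (fromℕ n) π c)) (toℕ-punchIn-top n (π ⟨$⟩ʳ c))

insert-at : ∀ {m n} i j (π : Permutation m n) → Perm.insert i j π ⟨$⟩ʳ i ≡ j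
insert-at i j π with i ≟ i
... | yes _   = refl
... | no  i≢i = contradiction refl i≢i

assign⁺ : ∀ {n} (b : Fin (suc n) → ℕ) c → suc n ≤ b c → Assignable n (b ∘ punchIn c) → Assignable (suc n) b
assign⁺ {n} b c n<bc (π , fits) = ρ , fits′
  where
  ρ : Permutation′ (suc n)
  ρ = Perm.insert c (fromℕ n) π
  fits′ : ∀ i → toℕ (ρ ⟨$⟩ʳ i) < b i
  fits′ i with c ≟ i
  ... | yes refl = ≤-trans (s≤s (≤-reflexive (toℕ-fromℕ n))) n<bc
  ... | no  c≢i  = subst (_≤ b i) (cong suc (sym (toℕ-punchIn-top n (π ⟨$⟩ʳ punchOut c≢i))))
                    (subst (λ i → toℕ (π ⟨$⟩ʳ punchOut c≢i) < b i) (punchIn-punchOut c≢i) (fits (punchOut c≢i)))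

-- Here c is arbitrary and need not be the one that the given vote puts on top. So whichever
-- candidate can take the top score may take it.
assign⁻ : ∀ {n} (b : Fin (suc n) → ℕ) c → Assignable (suc n) b → Assignable n (b ∘ punchIn c)
assign⁻ b c (π , fits) = Perm.remove c π , λ i → ≤-<-trans (remove-≤ c π i) (fits (punchIn c i))

greedy⁺ : ∀ n b → Assignable n b → greedy n (tabulate b) ≡ []
greedy⁺ zero    b _ = refl
greedy⁺ (suc n) b (π , fits) with dropFirst-spec (suc n) b
... | inj₁ (c , n<bc , dropped) = trans (cong (greedy n) dropped) (greedy⁺ n _ (assign⁻ b c (π , fits)))
-- The candidate that receives score n under the given vote has a budget above n, against `below`.
... | inj₂ (below , _) = contradiction
  (≤-trans (s≤s (subst (_< b c) (trans (cong toℕ (Perm.inverseʳ π)) (toℕ-fromℕ n)) (fits c))) (below c))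
  (n≮n (suc n))
  where c = π ⟨$⟩ˡ fromℕ n

greedy⁻ : ∀ n b → greedy n (tabulate b) ≡ [] → Assignable n b
greedy⁻ zero    b _  = Perm.id , λ ()
greedy⁻ (suc n) b eq with dropFirst-spec (suc n) b
... | inj₁ (c , n<bc , dropped) = assign⁺ b c n<bc (greedy⁻ n _ (trans (cong (greedy n) (sym dropped)) eq))
-- A round without removal leaves n rounds for n + 1 budgets, and a round removes at most one.
... | inj₂ (_ , same) = contradiction
  (subst₂ (λ l r → l ≤ n + length r) (length-tabulate b) (trans (cong (greedy n) (sym same)) eq) (greedy-length n (tabulate b)))
  (subst (λ x → ¬ suc n ≤ x) (sym (+-identityʳ n)) (n≮n n))

assignable⇒fits : ∀ {n b} → Assignable n b → Fits n 1 b
assignable⇒fits {b = b} (π , fits) = π ∷ [] , λ c → subst (_< b c) (sym (+-identityʳ _)) (fits c)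

fits⇒assignable : ∀ {n b} → Fits n 1 b → Assignable n b
fits⇒assignable {b = b} (π ∷ [] , fits) = π , λ c → subst (_< b c) (+-identityʳ _) (fits c)

-- From votes to gaps

accumulate-score : ∀ {m} (Π : List (Vote m)) g c → accumulate Π g c ≡ totalScore Π c + (length Π + g c)
accumulate-score []      g c = refl
accumulate-score (π ∷ Π) g c = trans (accumulate-score Π _ c)
  (arith (totalScore Π c) (length Π) (score π c) (g c))
  where
  arith : ∀ s l x y → s + (l + (suc x + y)) ≡ x + s + (suc l + y)
  arith s l x y = solve (s List.∷ l List.∷ x List.∷ y List.∷ List.[])

-- The totals are of positions, not scores; the excess, the number of votes, cancels.
-- The gap is 0 if c cannot be beaten.
gap : ∀ {m} → List (Vote m) → ℕ → Fin m → ℕ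
gap {m} Π t c = accumulate Π (const 0) p + t * m ∸ accumulate Π (const 0) (suc c)

gap⇔ : ∀ {m} (Π : List (Vote m)) t x c →
       (x < gap Π t c → totalScore Π (suc c) + x < totalScore Π p + t * m) ×
       (totalScore Π (suc c) + x < totalScore Π p + t * m → x < gap Π t c)
gap⇔ {m} Π t x c rewrite accumulate-score Π (const 0) p | accumulate-score Π (const 0) (suc c) = to , from
  where
  l = length Π + 0
  a = totalScore Π (suc c)
  b = totalScore Π p
  eq₁ : ∀ a x l → suc x + (a + l) ≡ suc (a + x) + l
  eq₁ a x l = solve (a List.∷ x List.∷ l List.∷ List.[])
  eq₂ : ∀ b l y → b + l + y ≡ b + y + l
  eq₂ b l y = solve (b List.∷ l List.∷ y List.∷ List.[])
  to : x < b + l + t * m ∸ (a + l) → a + x < b + t * m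
  to h = +-cancelʳ-≤ l _ _ (subst₂ _≤_ (eq₁ a x l) (eq₂ b l (t * m)) (m≤o∸n⇒m+n≤o _ a+l≤ h))
    where
    -- A truncated difference above x is nonzero, hence a genuine difference.
    a+l≤ : a + l ≤ b + l + t * m
    a+l≤ = <⇒≤ (m∸n≢0⇒n<m (λ e → n≮0 (subst (x <_) e h)))
  from : a + x < b + t * m → x < b + l + t * m ∸ (a + l)
  from h = m+n≤o⇒m≤o∸n (suc x) (subst₂ _≤_ (sym (eq₁ a x l)) (sym (eq₂ b l (t * m))) (+-monoˡ-≤ l h))

totalScore-++ : ∀ {m} (Π Π′ : List (Vote m)) c → totalScore (Π ++ Π′) c ≡ totalScore Π c + totalScore Π′ c
totalScore-++ []      Π′ c = refl
totalScore-++ (π ∷ Π) Π′ c = trans (cong (score π c +_) (totalScore-++ Π Π′ c)) (sym (+-assoc (score π c) _ _))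

totalScore-p-≤ : ∀ {m t} (Π : Vec (Vote m) t) → totalScore (Vec.toList Π) p ≤ t * m
totalScore-p-≤ []      = z≤n
totalScore-p-≤ (π ∷ Π) = +-mono-≤ (toℕ≤pred[n] (π ⟨$⟩ʳ zero)) (totalScore-p-≤ Π)

remove-total : ∀ {m t} (Π : Vec (Vote m) t) c →
               total (scores (Vec.map (Perm.remove zero) Π) c) ≤ totalScore (Vec.toList Π) (suc c)
remove-total []      c = z≤n
remove-total (π ∷ Π) c = +-mono-≤ (remove-≤ zero π c) (remove-total Π c)

promote : ∀ {m} → Permutation′ m → Vote m
promote {m} = Perm.insert zero (fromℕ m)

promote-p : ∀ {m t} (πs : Vec (Permutation′ m) t) → totalScore (Vec.toList (Vec.map promote πs)) p ≡ t * m
promote-p     []       = refl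
promote-p {m} (π ∷ πs) = cong₂ _+_ (trans (cong toℕ (insert-at zero (fromℕ m) π)) (toℕ-fromℕ m)) (promote-p πs)

promote-c : ∀ {m t} (πs : Vec (Permutation′ m) t) c →
            totalScore (Vec.toList (Vec.map promote πs)) (suc c) ≡ total (scores πs c)
promote-c []       c = refl
promote-c (π ∷ πs) c = cong₂ _+_ (insert-top zero π c) (promote-c πs c)

Manipulable : ∀ {m} → List (Vote m) → ℕ → Set
Manipulable {m} Π t = ∃ λ (Π′ : Vec (Vote m) t) → PWins (Π ++ Vec.toList Π′)

-- Striking p from the votes lowers the others' totals at most, and p never had more than m per
-- vote; so the p-on-top bound t m is harmless.
manipulable⇒fits : ∀ {m} (Π : List (Vote m)) t → Manipulable Π t → Fits m t (gap Π t)
manipulable⇒fits {m} Π t (Π′ , wins) = πs , λ c → proj₂ (gap⇔ Π t _ c) (begin-strict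
  totalScore Π (suc c) + total (scores πs c)                   ≤⟨ +-monoʳ-≤ (totalScore Π (suc c)) (remove-total Π′ c) ⟩
  totalScore Π (suc c) + totalScore (Vec.toList Π′) (suc c)    ≡⟨ totalScore-++ Π (Vec.toList Π′) (suc c) ⟨
  totalScore (Π ++ Vec.toList Π′) (suc c)                      <⟨ wins c ⟩
  totalScore (Π ++ Vec.toList Π′) p                            ≡⟨ totalScore-++ Π (Vec.toList Π′) p ⟩
  totalScore Π p + totalScore (Vec.toList Π′) p                ≤⟨ +-monoʳ-≤ (totalScore Π p) (totalScore-p-≤ Π′) ⟩
  totalScore Π p + t * m                                       ∎)
  where
  open ≤-Reasoning
  πs : Vec (Permutation′ m) t
  πs = Vec.map (Perm.remove zero) Π′

fits⇒manipulable : ∀ {m} (Π : List (Vote m)) t → Fits m t (gap Π t) → Manipulable Π t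
fits⇒manipulable {m} Π t (πs , fits) = Π′ , λ c → begin-strict
  totalScore (Π ++ Vec.toList Π′) (suc c)                      ≡⟨ totalScore-++ Π (Vec.toList Π′) (suc c) ⟩
  totalScore Π (suc c) + totalScore (Vec.toList Π′) (suc c)    ≡⟨ cong (totalScore Π (suc c) +_) (promote-c πs c) ⟩
  totalScore Π (suc c) + total (scores πs c)                   <⟨ proj₁ (gap⇔ Π t _ c) (fits c) ⟩
  totalScore Π p + t * m                                       ≡⟨ cong (totalScore Π p +_) (promote-p πs) ⟨
  totalScore Π p + totalScore (Vec.toList Π′) p                ≡⟨ totalScore-++ Π (Vec.toList Π′) p ⟨
  totalScore (Π ++ Vec.toList Π′) p                            ∎
  where
  open ≤-Reasoning
  Π′ : Vec (Vote m) t
  Π′ = Vec.map promote πs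

-- The whole program

-- Zero is encoded as `nil`, so `copiesᵖ` also produces the initial all-zero tally.
copies-nil : ∀ n → copies n nil ≡ encodeℕs (tabulate {n = n} (const 0))
copies-nil zero    = refl
copies-nil (suc n) = cong (nil ∙_) (copies-nil n)

σ : ℕ → ℕ
σ n = size (encodeℕ n)

budgetsᵖ : Function 3
budgetsᵖ = case (call tallyᵖ (v₁ ∷ call copiesᵖ ((nil ∙ v₀) ∷ nil ∷ []) ∷ [])) nil
  (call gapsᵖ (call addᵖ (v₀ ∷ call mulᵖ (v₄ ∷ v₂ ∷ []) ∷ []) ∷ v₁ ∷ []))

positions : ∀ {m} → List (Vote m) → Candidate m → ℕ
positions Π = accumulate Π (const 0)

budgetsCost : ∀ {m} → List (Vote m) → ℕ → ℕ
budgetsCost {m} Π t = 19 + (4 * σ (suc m) + (11 * size (encodeList encodeVote Π) + (σ t * (4 * σ m + 4)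
  + (4 * σ (positions Π p) + 9 * size (encodeℕs (tabulate (positions Π ∘ suc)))))))

budgetsᵖ-runs : ∀ {m} (Π : List (Vote m)) t →
  budgetsᵖ , encodeℕ m ∷ encodeList encodeVote Π ∷ encodeℕ t ∷ [] ⊢ budgetsᵖ ⇓ encodeℕs (tabulate (gap Π t))
  ⟨ budgetsCost Π t ⟩
budgetsᵖ-runs {m} Π t = relax
  (case∙ᵇ
    (callᵇ (varᵇ ∷ᵇ callᵇ (consᵇ nilᵇ varᵇ ∷ᵇ nilᵇ ∷ᵇ []ᵇ) zerosᵇ ∷ᵇ []ᵇ) (tallyᵖ-runs Π (const 0)))
    (callᵇ
      (callᵇ (varᵇ ∷ᵇ callᵇ (varᵇ ∷ᵇ varᵇ ∷ᵇ []ᵇ) (mulᵖ-runs t m) ∷ᵇ []ᵇ) (addᵖ-runs (positions Π p) (t * m))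
        ∷ᵇ varᵇ ∷ᵇ []ᵇ)
      (gapsᵖ-runs (positions Π p + t * m) (positions Π ∘ suc))))
  (arith (4 * σ (suc m)) (11 * size (encodeList encodeVote Π)) (σ t * (4 * σ m + 4))
         (4 * σ (positions Π p)) (9 * size (encodeℕs (tabulate (positions Π ∘ suc)))))
  where
  zerosᵇ : copiesᵖ , encodeℕ (suc m) ∷ nil ∷ [] ⊢ copiesᵖ ⇓ encodeℕs (tabulate {n = suc m} (const 0)) ⟨ 4 * σ (suc m) ⟩
  zerosᵇ = subst (λ T → copiesᵖ , encodeℕ (suc m) ∷ nil ∷ [] ⊢ copiesᵖ ⇓ T ⟨ 4 * σ (suc m) ⟩)
                 (copies-nil (suc m)) (copiesᵖ-runs (suc m) nil)
  arith : ∀ a b c d e → 1 + (1 + (6 + a + 0 + b) + (1 + (1 + (1 + (3 + c + 0) + d) + 1 + e)))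
          ≤ 19 + (a + (b + (c + (d + e))))
  arith a b c d e = ≤-slack 4 (solve (a List.∷ b List.∷ c List.∷ d List.∷ e List.∷ List.[]))

-- The arguments are |𝒞|, t, t - 1 and the gaps; the predecessor is passed along so that a single
-- case test recognises t = 1.
decideᵖ : Function 4
decideᵖ = case v₂
  (case (call greedyᵖ (v₀ ∷ v₃ ∷ [])) (nil ∙ nil) nil)
  (call cornerᵖ (v₂ ∷ call allotᵖ (v₅ ∷ v₃ ∷ v₂ ∷ call boxᵖ (v₂ ∷ (nil ∙ v₃) ∷ []) ∷ []) ∷ []))

mainᵖ : Program
mainᵖ = case v₀ nil (case v₁ nil (case v₁ nil
  (call decideᵖ (v₄ ∷ v₃ ∷ v₁ ∷ call budgetsᵖ (v₄ ∷ v₂ ∷ v₃ ∷ []) ∷ []))))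

greedyCost : ℕ → ℕ → ℕ
greedyCost m s = 9 + (1 + m) * (7 + 11 * s)

allotCost : ℕ → ℕ → ℕ → ℕ → ℕ
allotCost m t B s = 15 + (σ m * (4 * σ (suc t) + 5) +
  ((1 + m) * (16 + (4 * σ B + (1 + t) * stepCost B s)) + 4 * σ m))

decideᵖ-greedy : ∀ {m} (b : Fin m → ℕ) →
  ∃ λ a → decideᵖ , encodeℕ m ∷ encodeℕ 1 ∷ encodeℕ 0 ∷ encodeℕs (tabulate b) ∷ [] ⊢ decideᵖ ⇓ encodeBool a
            ⟨ greedyCost m (size (encodeℕs (tabulate b))) ⟩
          × Reflects (Fits m 1 b) a
decideᵖ-greedy {m} b with greedy m (tabulate b) | greedyᵖ-runs m (tabulate b) ≤-refl | greedy⁺ m b | greedy⁻ m b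
... | []    | run | _        | complete =
  true , relax (caseⁿᵇ varᵇ (caseⁿᵇ (callᵇ (varᵇ ∷ᵇ varᵇ ∷ᵇ []ᵇ) run) (consᵇ nilᵇ nilᵇ)))
               (arith ((1 + m) * (7 + 11 * size (encodeℕs (tabulate b)))))
       , ofʸ (assignable⇒fits (complete refl))
  where
  arith : ∀ a → 6 + (a + 3) ≤ 9 + a
  arith a = ≤-slack 0 (solve (a List.∷ List.[]))
... | _ ∷ _ | run | sound | _        =
  false , relax (caseⁿᵇ varᵇ (case∙ᵇ (callᵇ (varᵇ ∷ᵇ varᵇ ∷ᵇ []ᵇ) run) nilᵇ))
               (arith ((1 + m) * (7 + 11 * size (encodeℕs (tabulate b)))))
        , ofⁿ λ fits → contradiction (sound (fits⇒assignable fits)) λ ()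
  where
  arith : ∀ a → 6 + (a + 1) ≤ 9 + a
  arith a = ≤-slack 2 (solve (a List.∷ List.[]))

reflects-map : ∀ {P Q : Set} {a} → (P → Q) → (Q → P) → Reflects P a → Reflects Q a
reflects-map f g (ofʸ x)  = ofʸ (f x)
reflects-map f g (ofⁿ ¬x) = ofⁿ (¬x ∘ g)

-- A leaf inside the box is `nil` or `nil ∙ nil`, which are exactly the encoded Booleans, so the
-- leaf itself is the output.
readBit : ∀ {P : Set} {T} → T ⊑ nil ∙ nil → (P → Occupied T) → (Occupied T → P) →
          ∃ λ a → T ≡ encodeBool a × Reflects P a
readBit nil         sound complete = false , refl , ofⁿ sound
readBit (nil ∙ nil) sound complete = true , refl , ofʸ (complete tt)

decideᵖ-allot : ∀ {m} t t′ (b : Fin m → ℕ) {B s} → (∀ c → b c ≤ B) → size (copies B (box m (suc t))) ≤ s →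
  ∃ λ a → decideᵖ , encodeℕ m ∷ encodeℕ t ∷ encodeℕ (suc t′) ∷ encodeℕs (tabulate b) ∷ [] ⊢ decideᵖ ⇓ encodeBool a
            ⟨ allotCost m t B s ⟩
          × Reflects (Fits m t b) a
decideᵖ-allot {m} t t′ b {B} {s} b≤B h
  with a , eq , reflects ← readBit (allotment-⊑ m t (tabulate b)) (allotment⁺ b) (allotment⁻ b) =
  a , subst (λ T → decideᵖ , _ ⊢ decideᵖ ⇓ T ⟨ allotCost m t B s ⟩) eq run , reflects
  where
  arith : ∀ a b c → 3 + (1 + (1 + (3 + (1 + (4 + a)) + 0 + b) + 0) + c) ≤ 15 + (a + (b + c))
  arith a b c = ≤-slack 2 (solve (a List.∷ b List.∷ c List.∷ List.[]))
  allotᵇ : allotᵖ , encodeℕs (tabulate b) ∷ encodeℕ t ∷ encodeℕ m ∷ box m (suc t) ∷ [] ⊢ allotᵖ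
           ⇓ allot (tabulate b) t m (box m (suc t))
           ⟨ (1 + m) * (16 + (4 * σ B + (1 + t) * stepCost B s)) ⟩
  allotᵇ = subst (λ l → allotᵖ , encodeℕs (tabulate b) ∷ encodeℕ t ∷ encodeℕ m ∷ box m (suc t) ∷ [] ⊢ allotᵖ
           ⇓ allot (tabulate b) t m (box m (suc t))
           ⟨ (1 + l) * (16 + (4 * σ B + (1 + t) * stepCost B s)) ⟩) (length-tabulate b)
           (allotᵖ-runs t m (suc t) (tabulate⁺ b≤B) ⊑-refl h)
  run : decideᵖ , encodeℕ m ∷ encodeℕ t ∷ encodeℕ (suc t′) ∷ encodeℕs (tabulate b) ∷ [] ⊢ decideᵖ
        ⇓ allotment m t (tabulate b) ⟨ allotCost m t B s ⟩
  run = relax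
    (case∙ᵇ varᵇ (callᵇ
      (varᵇ ∷ᵇ callᵇ
        (varᵇ ∷ᵇ varᵇ ∷ᵇ varᵇ ∷ᵇ callᵇ (varᵇ ∷ᵇ consᵇ nilᵇ varᵇ ∷ᵇ []ᵇ) (boxᵖ-runs m (suc t)) ∷ᵇ []ᵇ)
        allotᵇ ∷ᵇ []ᵇ)
      (cornerᵖ-runs m (allot (tabulate b) t m (box m (suc t))))))
    (arith (σ m * (4 * σ (suc t) + 5)) ((1 + m) * (16 + (4 * σ B + (1 + t) * stepCost B s))) (4 * σ m))

-- Size of the table

copies-size : ∀ n T → size (copies n T) ≡ 1 + n * (1 + size T)
copies-size zero    T = refl
copies-size (suc n) T = cong suc (trans (cong (size T +_) (copies-size n T)) (+-suc (size T) _))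

-- The 3 strengthens the induction: with branching a = 2 + n the step needs 4 + a ≤ 3 a, which holds
-- from a = 2 on. The 6 is the value at a leaf of size 3.
box-size : ∀ m n → size (box m (2 + n)) + 3 ≤ 6 * (2 + n) ^ m
box-size zero    n = ≤-refl
box-size (suc m) n = begin
  size (copies (2 + n) (box m (2 + n))) + 3     ≡⟨ cong (_+ 3) (copies-size (2 + n) (box m (2 + n))) ⟩
  1 + (2 + n) * (1 + size (box m (2 + n))) + 3  ≤⟨ arith n (size (box m (2 + n))) ⟩
  (2 + n) * (size (box m (2 + n)) + 3)          ≤⟨ *-monoʳ-≤ (2 + n) (box-size m n) ⟩
  (2 + n) * (6 * (2 + n) ^ m)                   ≡⟨ reorder (2 + n) ((2 + n) ^ m) ⟩
  6 * (2 + n) ^ suc m                           ∎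
  where
  open ≤-Reasoning
  arith : ∀ n s → 1 + (2 + n) * (1 + s) + 3 ≤ (2 + n) * (s + 3)
  arith n s = ≤-slack (2 * n) (solve (n List.∷ s List.∷ List.[]))
  reorder : ∀ a b → a * (6 * b) ≡ 6 * (a * b)
  reorder a b = solve (a List.∷ b List.∷ List.[])

box-size-≤ : ∀ m t → size (box m (3 + t)) ≤ 6 * (2 + t) ^ (2 * m)
box-size-≤ m t = begin
  size (box m (3 + t))      ≤⟨ m≤m+n _ 3 ⟩
  size (box m (3 + t)) + 3  ≤⟨ box-size m (1 + t) ⟩
  6 * (3 + t) ^ m           ≤⟨ *-monoʳ-≤ 6 (^-monoˡ-≤ m (arith t)) ⟩
  6 * ((2 + t) ^ 2) ^ m     ≡⟨ cong (6 *_) (^-*-assoc (2 + t) 2 m) ⟩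
  6 * (2 + t) ^ (2 * m)     ∎
  where
  open ≤-Reasoning
  arith : ∀ t → 3 + t ≤ (2 + t) * ((2 + t) * 1)
  arith t = ≤-slack (1 + 3 * t + t * t) (solve (t List.∷ List.[]))

budget : ∀ {m} → List (Vote m) → ℕ → ℕ
budget {m} Π t = positions Π p + t * m

-- A formula rather than the actual size: for t = 1 the box has 2^|𝒞| leaves, which the formula does
-- not allow for, but there the greedy branch runs.
tableSize : ∀ {m} → List (Vote m) → ℕ → ℕ
tableSize {m} Π t = 1 + budget Π t * (1 + 6 * (1 ⊔ t) ^ (2 * m))

tableSize-≥ : ∀ {m} (Π : List (Vote m)) t → size (box m (suc t)) ≤ 6 * (1 ⊔ t) ^ (2 * m) →
              size (copies (budget Π t) (box m (suc t))) ≤ tableSize Π t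
tableSize-≥ {m} Π t h = ≤-trans (≤-reflexive (copies-size (budget Π t) (box m (suc t))))
  (s≤s (*-monoʳ-≤ (budget Π t) (s≤s h)))

-- A sum, so that one expression bounds whichever branch is taken.
branchCost : ∀ {m} → List (Vote m) → ℕ → ℕ
branchCost {m} Π t = greedyCost m (size (encodeℕs (tabulate (gap Π t)))) + allotCost m t (budget Π t) (tableSize Π t)

cost : ∀ {m} → List (Vote m) → ℕ → ℕ
cost Π t = 14 + (budgetsCost Π t + branchCost Π t)

gap-≤ : ∀ {m} (Π : List (Vote m)) t c → gap Π t c ≤ budget Π t
gap-≤ Π t c = m∸n≤m (budget Π t) (positions Π (suc c))

branch-greedy : ∀ {m} (Π : List (Vote m)) →
  ∃ λ a → decideᵖ , encodeℕ m ∷ encodeℕ 1 ∷ encodeℕ 0 ∷ encodeℕs (tabulate (gap Π 1)) ∷ [] ⊢ decideᵖ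
            ⇓ encodeBool a ⟨ branchCost Π 1 ⟩
        × Reflects (Manipulable Π 1) a
branch-greedy {m} Π = map₂
  (map (λ run → relax run (m≤m+n (greedyCost m (size (encodeℕs (tabulate (gap Π 1))))) (allotCost m 1 (budget Π 1) (tableSize Π 1))))
       (reflects-map (fits⇒manipulable Π 1) (manipulable⇒fits Π 1)))
  (decideᵖ-greedy (gap Π 1))

branch-allot : ∀ {m} (Π : List (Vote m)) t t′ → size (box m (suc t)) ≤ 6 * (1 ⊔ t) ^ (2 * m) →
  ∃ λ a → decideᵖ , encodeℕ m ∷ encodeℕ t ∷ encodeℕ (suc t′) ∷ encodeℕs (tabulate (gap Π t)) ∷ [] ⊢ decideᵖ
            ⇓ encodeBool a ⟨ branchCost Π t ⟩
        × Reflects (Manipulable Π t) a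
branch-allot {m} Π t t′ h = map₂
  (map (λ run → relax run (m≤n+m (allotCost m t (budget Π t) (tableSize Π t)) (greedyCost m (size (encodeℕs (tabulate (gap Π t)))))))
       (reflects-map (fits⇒manipulable Π t) (manipulable⇒fits Π t)))
  (decideᵖ-allot t t′ (gap Π t) {budget Π t} {tableSize Π t} (gap-≤ Π t) (tableSize-≥ Π t h))

mainᵖ-decides : ∀ {m} (Π : List (Vote m)) t {T} →
  decideᵖ , encodeℕ m ∷ encodeℕ (suc t) ∷ encodeℕ t ∷ encodeℕs (tabulate (gap Π (suc t))) ∷ [] ⊢ decideᵖ
    ⇓ T ⟨ branchCost Π (suc t) ⟩ →
  mainᵖ , (encodeℕ m ∙ encodeList encodeVote Π ∙ encodeℕ (suc t)) ∷ [] ⊢ mainᵖ ⇓ T ⟨ cost Π (suc t) ⟩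
mainᵖ-decides Π t run = relax
  (case∙ᵇ varᵇ (case∙ᵇ varᵇ (case∙ᵇ varᵇ (callᵇ
    (varᵇ ∷ᵇ varᵇ ∷ᵇ varᵇ ∷ᵇ callᵇ (varᵇ ∷ᵇ varᵇ ∷ᵇ varᵇ ∷ᵇ []ᵇ) (budgetsᵖ-runs Π (suc t)) ∷ᵇ []ᵇ)
    run))))
  (arith (budgetsCost Π (suc t)) (branchCost Π (suc t)))
  where
  arith : ∀ a b → 10 + (4 + a + 0 + b) ≤ 14 + (a + b)
  arith a b = ≤-slack 0 (solve (a List.∷ b List.∷ List.[]))

mainᵖ-runs : ∀ {m} (Π : List (Vote m)) t → ¬ PWins Π →
  ∃ λ a → mainᵖ , (encodeℕ m ∙ encodeList encodeVote Π ∙ encodeℕ t) ∷ [] ⊢ mainᵖ ⇓ encodeBool a ⟨ cost Π t ⟩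
        × Reflects (Manipulable Π t) a
-- Without manipulators the election stays as it is, and p does not win it.
mainᵖ-runs Π 0 ¬win =
  false , relax (case∙ᵇ varᵇ (case∙ᵇ varᵇ (caseⁿᵇ varᵇ nilᵇ))) (≤-trans (m≤m+n 7 7) (m≤m+n 14 _))
  , ofⁿ λ { ([] , wins) → ¬win (subst PWins (++-identityʳ Π) wins) }
mainᵖ-runs     Π 1             _ = map₂ (map (mainᵖ-decides Π 0) id) (branch-greedy Π)
mainᵖ-runs {m} Π (suc (suc t)) _ = map₂ (map (mainᵖ-decides Π (suc t)) id)
  (branch-allot Π (suc (suc t)) t (box-size-≤ m t))

-- Polynomial factors

inputSize : UBMInstance → ℕ
inputSize I = size (encodeUBM I)

infix 4 _⊴_

record _⊴_ (f g : UBMInstance → ℕ) : Set where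
  constructor poly
  field
    factor degree : ℕ
    bound         : ∀ I → f I ≤ factor * inputSize I ^ degree * g I

one : UBMInstance → ℕ
one = const 1

inputSize^-mono : ∀ I {d e} → d ≤ e → inputSize I ^ d ≤ inputSize I ^ e
inputSize^-mono I = ^-monoʳ-≤ (inputSize I) {{>-nonZero (size≥1 (encodeUBM I))}}

module _ {g : UBMInstance → ℕ} where

  ⊴-≤ : ∀ {f f′} → (∀ I → f I ≤ f′ I) → f′ ⊴ g → f ⊴ g
  ⊴-≤ f≤f′ (poly c d bound) = poly c d λ I → ≤-trans (f≤f′ I) (bound I)

  ⊴-cong : ∀ {f f′} → f′ ⊴ g → (∀ I → f I ≡ f′ I) → f ⊴ g
  ⊴-cong f′⊴g f≡f′ = ⊴-≤ (λ I → ≤-reflexive (f≡f′ I)) f′⊴g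

  -- Both monomials are raised to the common degree d₁ + d₂, which is sound because the input size
  -- is at least 1.
  ⊴-+ : ∀ {f₁ f₂} → f₁ ⊴ g → f₂ ⊴ g → (λ I → f₁ I + f₂ I) ⊴ g
  ⊴-+ {f₁} {f₂} (poly c₁ d₁ bound₁) (poly c₂ d₂ bound₂) = poly (c₁ + c₂) (d₁ + d₂) λ I → begin
    f₁ I + f₂ I
      ≤⟨ +-mono-≤ (bound₁ I) (bound₂ I) ⟩
    c₁ * inputSize I ^ d₁ * g I + c₂ * inputSize I ^ d₂ * g I
      ≤⟨ +-mono-≤ (*-monoˡ-≤ (g I) (*-monoʳ-≤ c₁ (inputSize^-mono I (m≤m+n d₁ d₂))))
                  (*-monoˡ-≤ (g I) (*-monoʳ-≤ c₂ (inputSize^-mono I (m≤n+m d₂ d₁)))) ⟩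
    c₁ * inputSize I ^ (d₁ + d₂) * g I + c₂ * inputSize I ^ (d₁ + d₂) * g I
      ≡⟨ arith c₁ c₂ (inputSize I ^ (d₁ + d₂)) (g I) ⟩
    (c₁ + c₂) * inputSize I ^ (d₁ + d₂) * g I ∎
    where
    open ≤-Reasoning
    arith : ∀ a b x y → a * x * y + b * x * y ≡ (a + b) * x * y
    arith a b x y = solve (a List.∷ b List.∷ x List.∷ y List.∷ List.[])

  -- One factor must be polynomial, for otherwise the exponential term would be squared.
  ⊴-* : ∀ {f₁ f₂} → f₁ ⊴ one → f₂ ⊴ g → (λ I → f₁ I * f₂ I) ⊴ g
  ⊴-* {f₁} {f₂} (poly c₁ d₁ bound₁) (poly c₂ d₂ bound₂) = poly (c₁ * c₂) (d₁ + d₂) λ I → begin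
    f₁ I * f₂ I
      ≤⟨ *-mono-≤ (bound₁ I) (bound₂ I) ⟩
    c₁ * inputSize I ^ d₁ * 1 * (c₂ * inputSize I ^ d₂ * g I)
      ≡⟨ arith c₁ c₂ (inputSize I ^ d₁) (inputSize I ^ d₂) (g I) ⟩
    c₁ * c₂ * (inputSize I ^ d₁ * inputSize I ^ d₂) * g I
      ≡⟨ cong (λ x → c₁ * c₂ * x * g I) (^-distribˡ-+-* (inputSize I) d₁ d₂) ⟨
    c₁ * c₂ * inputSize I ^ (d₁ + d₂) * g I ∎
    where
    open ≤-Reasoning
    arith : ∀ a b x y z → a * x * 1 * (b * y * z) ≡ a * b * (x * y) * z
    arith a b x y z = solve (a List.∷ b List.∷ x List.∷ y List.∷ z List.∷ List.[])

  ⊴-refl : g ⊴ g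
  ⊴-refl = poly 1 0 λ I → ≤-reflexive (sym (*-identityˡ (g I)))

⊴-one : ∀ {f g} → (∀ I → 1 ≤ g I) → f ⊴ one → f ⊴ g
⊴-one 1≤g (poly c d bound) = poly c d λ I → ≤-trans (bound I) (*-monoʳ-≤ (c * inputSize I ^ d) (1≤g I))

⊴-const : ∀ k → const k ⊴ one
⊴-const k = poly k 0 λ I → ≤-reflexive (sym (trans (*-identityʳ (k * 1)) (*-identityʳ k)))

⊴-inputSize : inputSize ⊴ one
⊴-inputSize = poly 1 1 λ I → ≤-reflexive (arith (inputSize I))
  where
  arith : ∀ a → a ≡ 1 * (a * 1) * 1
  arith a = solve (a List.∷ List.[])

⊴-σ : ∀ {x} → x ⊴ one → (λ I → σ (x I)) ⊴ one
⊴-σ {x} h = ⊴-cong (⊴-+ (⊴-const 1) (⊴-* (⊴-const 2) h)) (λ I → size-encodeℕ (x I))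
  where
  size-encodeℕ : ∀ n → σ n ≡ 1 + 2 * n
  size-encodeℕ zero    = refl
  size-encodeℕ (suc n) = cong (2 +_) (trans (size-encodeℕ n) (sym (+-suc n (n + 0))))

n≤σ : ∀ n → n ≤ σ n
n≤σ zero    = z≤n
n≤σ (suc n) = s≤s (m≤n⇒m≤1+n (n≤σ n))

tabulate-size : ∀ {n} (f : Fin n → ℕ) b → (∀ i → f i ≤ b) → size (encodeℕs (tabulate f)) ≤ 1 + n * (1 + σ b)
tabulate-size {zero}  f b f≤b = ≤-refl
tabulate-size {suc n} f b f≤b = s≤s (≤-trans
  (+-mono-≤ (encodeℕ-size-mono (f≤b zero)) (tabulate-size (f ∘ suc) b (f≤b ∘ suc)))
  (≤-reflexive (+-suc (σ b) _)))

member≤size : ∀ {n} (f : Fin n → ℕ) i → f i ≤ size (encodeℕs (tabulate f))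
member≤size f zero    = m≤n⇒m≤1+n (≤-trans (n≤σ (f zero)) (m≤m+n (σ (f zero)) _))
member≤size f (suc i) = m≤n⇒m≤1+n (≤-trans (member≤size (f ∘ suc) i) (m≤n+m _ (σ (f zero))))

accumulate-≤ : ∀ {m} (Π : List (Vote m)) g c → accumulate Π g c ≤ size (encodeList encodeVote Π) + g c
accumulate-≤ []      g c = n≤1+n (g c)
accumulate-≤ (π ∷ Π) g c = begin
  accumulate Π (λ c → position π c + g c) c                            ≤⟨ accumulate-≤ Π _ c ⟩
  size (encodeList encodeVote Π) + (position π c + g c)                ≤⟨ +-monoʳ-≤ _ (+-monoˡ-≤ (g c) (member≤size (position π) c)) ⟩
  size (encodeList encodeVote Π) + (size (encodeVote π) + g c)         ≤⟨ arith (size (encodeVote π)) (size (encodeList encodeVote Π)) (g c) ⟩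
  suc (size (encodeVote π) + size (encodeList encodeVote Π)) + g c     ∎
  where
  open ≤-Reasoning
  arith : ∀ a b c → b + (a + c) ≤ suc (a + b) + c
  arith a b c = ≤-slack 1 (solve (a List.∷ b List.∷ c List.∷ List.[]))

-- Unary encoding makes every position at most the size of its code; hence the table of allowances
-- has polynomial length.
positions-≤ : ∀ {m} (Π : List (Vote m)) c → positions Π c ≤ size (encodeList encodeVote Π)
positions-≤ Π c = ≤-trans (accumulate-≤ Π (const 0) c) (≤-reflexive (+-identityʳ _))

-- The base is t for t ≥ 1. For t = 0 the plain power would be 0, since |𝒞| > 0 when p is not the
-- winner, yet any run takes at least one step.
exponential : UBMInstance → ℕ
exponential I = (1 ⊔ #manipulators I) ^ (2 * #candidates I)

1≤exponential : ∀ I → 1 ≤ exponential I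
1≤exponential I = m^n>0 (1 ⊔ #manipulators I) {{>-nonZero (m≤m⊔n 1 (#manipulators I))}} (2 * #candidates I)

⊴-candidates : #candidates ⊴ one
⊴-candidates = ⊴-≤ (λ I → ≤-trans (n≤σ (#candidates I)) (m≤n⇒m≤1+n (m≤m+n _ _))) ⊴-inputSize

⊴-votes : (λ I → size (encodeList encodeVote (votes I))) ⊴ one
⊴-votes = ⊴-≤ (λ I → m≤n⇒m≤1+n (m≤n⇒m≤o+n (σ (#candidates I)) (m≤n⇒m≤1+n (m≤m+n _ _)))) ⊴-inputSize

⊴-manipulators : #manipulators ⊴ one
⊴-manipulators = ⊴-≤ (λ I → m≤n⇒m≤1+n (m≤n⇒m≤o+n (σ (#candidates I)) (m≤n⇒m≤1+n
  (m≤n⇒m≤o+n (size (encodeList encodeVote (votes I))) (n≤σ (#manipulators I)))))) ⊴-inputSize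

⊴-positions : (λ I → positions (votes I) p) ⊴ one
⊴-positions = ⊴-≤ (λ I → positions-≤ (votes I) p) ⊴-votes

⊴-tabulate : (f : ∀ I → Fin (#candidates I) → ℕ) (b : UBMInstance → ℕ) → (∀ I c → f I c ≤ b I) → b ⊴ one →
             (λ I → size (encodeℕs (tabulate (f I)))) ⊴ one
⊴-tabulate f b f≤b h = ⊴-≤ (λ I → tabulate-size (f I) (b I) (f≤b I))
  (⊴-cong (⊴-+ (⊴-const 1) (⊴-* ⊴-candidates (⊴-+ (⊴-const 1) (⊴-σ h)))) λ I → refl)

⊴-budget : (λ I → budget (votes I) (#manipulators I)) ⊴ one
⊴-budget = ⊴-cong
  (⊴-+ ⊴-positions (⊴-* ⊴-manipulators ⊴-candidates))
  λ I → refl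

⊴-budgetsCost : (λ I → budgetsCost (votes I) (#manipulators I)) ⊴ one
⊴-budgetsCost = ⊴-cong
  (⊴-+ (⊴-const 19)
  (⊴-+ (⊴-* (⊴-const 4) (⊴-σ (⊴-+ (⊴-const 1) ⊴-candidates)))
  (⊴-+ (⊴-* (⊴-const 11) ⊴-votes)
  (⊴-+ (⊴-* (⊴-σ ⊴-manipulators) (⊴-+ (⊴-* (⊴-const 4) (⊴-σ ⊴-candidates)) (⊴-const 4)))
  (⊴-+ (⊴-* (⊴-const 4) (⊴-σ ⊴-positions))
       (⊴-* (⊴-const 9) (⊴-tabulate (λ I → positions (votes I) ∘ suc) (λ I → size (encodeList encodeVote (votes I)))
                           (λ I c → positions-≤ (votes I) (suc c)) ⊴-votes)))))))
  λ I → refl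

⊴-greedyCost : (λ I → greedyCost (#candidates I) (size (encodeℕs (tabulate (gap (votes I) (#manipulators I)))))) ⊴ one
⊴-greedyCost = ⊴-cong
  (⊴-+ (⊴-const 9)
  (⊴-* (⊴-+ (⊴-const 1) ⊴-candidates)
  (⊴-+ (⊴-const 7)
  (⊴-* (⊴-const 11)
       (⊴-tabulate (λ I → gap (votes I) (#manipulators I)) (λ I → budget (votes I) (#manipulators I))
         (λ I → gap-≤ (votes I) (#manipulators I)) ⊴-budget)))))
  λ I → refl

⊴-tableSize : (λ I → tableSize (votes I) (#manipulators I)) ⊴ exponential
⊴-tableSize = ⊴-cong
  (⊴-+ (⊴-one 1≤exponential (⊴-const 1))
  (⊴-* ⊴-budget (⊴-+ (⊴-one 1≤exponential (⊴-const 1)) (⊴-* (⊴-const 6) ⊴-refl))))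
  λ I → refl

⊴-allotCost : (λ I → allotCost (#candidates I) (#manipulators I) (budget (votes I) (#manipulators I))
                               (tableSize (votes I) (#manipulators I))) ⊴ exponential
⊴-allotCost = ⊴-cong
  (⊴-+ (⊴-one 1≤exponential (⊴-const 15))
  (⊴-+ (⊴-one 1≤exponential (⊴-* (⊴-σ ⊴-candidates)
         (⊴-+ (⊴-* (⊴-const 4) (⊴-σ (⊴-+ (⊴-const 1) ⊴-manipulators))) (⊴-const 5))))
  (⊴-+ (⊴-* (⊴-+ (⊴-const 1) ⊴-candidates)
       (⊴-+ (⊴-one 1≤exponential (⊴-const 16))
       (⊴-+ (⊴-one 1≤exponential (⊴-* (⊴-const 4) (⊴-σ ⊴-budget)))
            (⊴-* (⊴-+ (⊴-const 1) ⊴-manipulators)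
            (⊴-+ (⊴-one 1≤exponential (⊴-const 8))
                 (⊴-* (⊴-const 32) (⊴-* (⊴-+ (⊴-const 1) ⊴-budget) ⊴-tableSize)))))))
       (⊴-one 1≤exponential (⊴-* (⊴-const 4) (⊴-σ ⊴-candidates))))))
  λ I → refl

⊴-cost : (λ I → cost (votes I) (#manipulators I)) ⊴ exponential
⊴-cost = ⊴-cong
  (⊴-+ (⊴-one 1≤exponential (⊴-const 14))
  (⊴-+ (⊴-one 1≤exponential ⊴-budgetsCost) (⊴-+ (⊴-one 1≤exponential ⊴-greedyCost) ⊴-allotCost)))
  λ I → refl

solvable : ∀ {g} → (λ I → cost (votes I) (#manipulators I)) ⊴ g → SolvableInTimeO* UBM g
solvable (poly factor degree bound) = mainᵖ , factor , degree , λ I → map₂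
  (λ { (within {k} run k≤cost , reflects) → k , run , reflects , ≤-trans k≤cost (bound I) })
  (mainᵖ-runs (votes I) (#manipulators I) (p-not-winner I))

theorem1 : SolvableInTimeO* UBM (λ I → (1 ⊔ #manipulators I) ^ (2 * #candidates I))
theorem1 = solvable ⊴-cost
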